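{- Let $k\geq 3$ be an odd integer. There exists a strictly Deza dihedrant with $8k$ vertices whose WL-rank equals $6k$. Explicitly, one may take $\Sigma(k)=\mathrm{Cay}(G,Z)$, where $G=\langle x,y:~x^{4k}=y^2=e,~yxy=x^{ -1}\rangle$, $A_1=\langle x^4\rangle$, and $Z=x^2A_1\cup y(A_1\setminus\{x^{2(k-1)}\})\cup\{yx^{2k-1},yx^{ -2},yx^{ -1}\}$.
   Context: All graphs are finite, undirected, without loops and multiple edges. For $S\subseteq G$ with $e\notin S$, $S=S^{ -1}$, $\mathrm{Cay}(G,S)$ has vertex set $G$ and edges $\{g,sg\}$. A dihedrant is a graph isomorphic to a Cayley graph over a dihedral group. A $k$-regular graph is a Deza graph if there are nonnegative integers $a,b$ such that every pair of distinct vertices has either $a$ or $b$ common neighbours; it is strictly Deza if moreover it is not strongly regular and has diameter $2$. The WL-rank of $\mathrm{Cay}(G,S)$ is the number of basic sets of the smallest S-ring over $G$ in which $S$ is a union of basic sets (equivalently, the rank of the coherent configuration generated by the graph). An S-ring over $G$ is a subring $\mathcal{A}$ of $\mathbb{Z}G$ spanned by elements $\underline{X}=\sum_{x\in X}x$, $X$ ranging over a partition $\mathcal{S}(\mathcal{A})$ of $G$ (the basic sets) with $\{e\}\in\mathcal{S}(\mathcal{A})$ and $X^{ -1}\in\mathcal{S}(\mathcal{A})$ whenever $X\in\mathcal{S}(\mathcal{A})$. -}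

module Defs where

open import Data.Nat using (ℕ; zero; suc; _+_; _*_; _∸_; _≤_; NonZero)
open import Data.Nat.Properties using (m*n≢0)
open import Data.Nat.DivMod using (_mod_)
open import Data.Fin as Fin using (Fin; toℕ)
open import Data.Bool using (Bool; true; false; _∧_; _∨_; not; _xor_; if_then_else_)
open import Data.Bool.Properties using () renaming (_≟_ to _≟B_)
open import Data.Product using (Σ; ∃; _×_; _,_)
open import Data.Product.Properties using (≡-dec)
open import Data.Sum using (_⊎_)
open import Data.List using (List; []; _∷_; _++_; map; filter; filterᵇ; length; cartesianProduct; allFin; upTo)
open import Data.Bool.ListAction using (any)
open import Relation.Nullary using (¬_; does)
open import Relation.Binary.PropositionalEquality using (_≡_; _≢_)
open import Relation.Binary.Definitions using (DecidableEquality)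

Odd : ℕ → Set
Odd k = ∃ λ m → k ≡ suc (2 * m)

-- Finite (simple) graphs given by a vertex type V, a list `vs`
-- enumerating all vertices (each exactly once) and a Boolean
-- adjacency relation.

module FinGraph {V : Set} (vs : List V) (adj : V → V → Bool) where

  count : (V → Bool) → ℕ
  count p = length (filterᵇ p vs)

  common : V → V → ℕ
  common u v = count (λ w → adj u w ∧ adj w v)

  Regular : ℕ → Set
  Regular r = ∀ v → count (adj v) ≡ r

  IsDeza : Set
  IsDeza = Σ ℕ λ r → Σ ℕ λ a → Σ ℕ λ b →
    Regular r × (∀ u v → u ≢ v → (common u v ≡ a) ⊎ (common u v ≡ b))

  IsSRG : Set
  IsSRG = Σ ℕ λ r → Σ ℕ λ l → Σ ℕ λ m →
    Regular r
    × (∀ u v → u ≢ v → adj u v ≡ true  → common u v ≡ l)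
    × (∀ u v → u ≢ v → adj u v ≡ false → common u v ≡ m)

  Diameter2 : Set
  Diameter2 =
    (∀ u v → u ≢ v → (adj u v ≡ true) ⊎ (∃ λ w → (adj u w ∧ adj w v) ≡ true))
    × (∃ λ u → ∃ λ v → u ≢ v × adj u v ≡ false)

  IsStrictlyDeza : Set
  IsStrictlyDeza = IsDeza × ¬ IsSRG × Diameter2

-- The dihedral group D_n = ⟨x, y : x^n = y^2 = e, yxy = x^{-1}⟩ of
-- order 2n.  The element (b , j) stands for y^b x^j (b = true ↔ y^1).

module Dihedral (n : ℕ) .{{_ : NonZero n}} where

  Elt : Set
  Elt = Bool × Fin n

  xexp : ℕ → Fin n
  xexp a = a mod n

  addₓ : Fin n → Fin n → Fin n
  addₓ i j = xexp (toℕ i + toℕ j)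

  negₓ : Fin n → Fin n
  negₓ i = xexp (n ∸ toℕ i)

  e : Elt
  e = (false , xexp 0)

  x^ : ℕ → Elt
  x^ a = (false , xexp a)

  y : Elt
  y = (true , xexp 0)

  -- (y^a x^b)(y^c x^d) = y^(a+c) x^((-1)^c b + d)
  _·_ : Elt → Elt → Elt
  (a , b) · (c , d) = (a xor c , addₓ (if c then negₓ b else b) d)

  inv : Elt → Elt
  inv (false , b) = (false , negₓ b)
  inv (true  , b) = (true  , b)

  _≟_ : DecidableEquality Elt
  _≟_ = ≡-dec _≟B_ Fin._≟_

  elements : List Elt
  elements = cartesianProduct (false ∷ true ∷ []) (allFin n)

  count : (Elt → Bool) → ℕ
  count p = length (filterᵇ p elements)

  _∈ᵇ_ : Elt → List Elt → Bool
  g ∈ᵇ xs = any (λ h → does (g ≟ h)) xs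

  CayAdj : (Elt → Bool) → Elt → Elt → Bool
  CayAdj S g h = S (h · inv g)

  module Cay (S : Elt → Bool) = FinGraph elements (CayAdj S)

  -- S-rings.  A partition of G into r (nonempty) classes is given by a
  -- surjective colouring  c : G → Fin r ; the basic sets are its fibres
  -- X_i = c⁻¹(i).

  -- coefficient of z in the product X_i · X_j in ℤG
  coeff : ∀ {r} → (Elt → Fin r) → Fin r → Fin r → Elt → ℕ
  coeff c i j z = count (λ a → does (c a Fin.≟ i) ∧ does (c (inv a · z) Fin.≟ j))

  IsSRing : ∀ {r} → (Elt → Fin r) → Set
  IsSRing {r} c =
    (∀ i → ∃ λ g → c g ≡ i)
    × (∀ g → c g ≡ c e → g ≡ e)
    × (∀ g h → c g ≡ c h → c (inv g) ≡ c (inv h))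
    -- the span of the X̲ is closed under multiplication:
    -- every product X̲_i X̲_j has constant coefficients on basic sets
    × (∀ i j z z' → c z ≡ c z' → coeff c i j z ≡ coeff c i j z')

  IsUnionOfBasic : ∀ {r} → (Elt → Bool) → (Elt → Fin r) → Set
  IsUnionOfBasic S c = ∀ g h → c g ≡ c h → S g ≡ S h

  SubRing : ∀ {r r'} → (Elt → Fin r) → (Elt → Fin r') → Set
  SubRing c c' = ∀ g h → c' g ≡ c' h → c g ≡ c h

  WLRank : (Elt → Bool) → ℕ → Set
  WLRank S r = Σ (Elt → Fin r) λ c →
    IsSRing c × IsUnionOfBasic S c
    × (∀ r' (c' : Elt → Fin r') → IsSRing c' → IsUnionOfBasic S c' → SubRing c c')

instance
  4k-nonZero : ∀ {k} .{{_ : NonZero k}} → NonZero (4 * k)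
  4k-nonZero {k} = m*n≢0 4 k

module SigmaK (k : ℕ) .{{_ : NonZero k}} where
  open Dihedral (4 * k)

  -- A₁ = ⟨x⁴⟩ = { x^(4t) : t ∈ ℕ } (t < 4k suffices)
  A₁ : List Elt
  A₁ = map (λ t → x^ (4 * t)) (upTo (4 * k))

  Zlist : List Elt
  Zlist = map (x^ 2 ·_) A₁
       ++ map (y ·_) (filterᵇ (λ a → not (does (a ≟ x^ (2 * (k ∸ 1))))) A₁)
       ++ (y · x^ (2 * k ∸ 1)) ∷ (y · inv (x^ 2)) ∷ (y · inv (x^ 1)) ∷ []

  Z : Elt → Bool
  Z g = g ∈ᵇ Zlist

{-# OPTIONS --safe #-}

-- Write Z = x²A₁ ∪ yB, and call the number of a ∈ Z with a⁻¹z ∈ Z the number of factorisations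
-- of z; it equals the number of common neighbours of u and v when z = vu⁻¹.  B differs from A₁
-- by one missing element and three extra ones, one in each other coset of A₁ in ⟨x⟩, so these
-- numbers can be read off coset by coset: 2k − 2 if e ≠ z ∈ A₁ ∪ yx²A₁, and 2 for the other z ≠ e.
--
-- The sets {g} (even exponent) and {g, gx^(2k)} (odd exponent) are the basic sets of an S-ring:
-- multiplying the elements with odd exponent by the central involution x^(2k) is a bijection
-- that carries factorisations of z to factorisations of zx^(2k) when z is odd.  Conversely, in
-- an S-ring for which Z is a union of basic sets, s = yx⁻² is the only element of Z with 2k − 2
-- factorisations, so {s} is basic.  Hence sZ ∖ Zs = {x, x^(2k+1)} is a union of basic sets, and
-- multiplying Z ∖ sZ ∖ {s} = {x^(2k), yx⁻¹, yx^(2k−1)} by it and intersecting with Z isolates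
-- y.  Now y and ys = x⁻² generate all elements with even exponent, and the odd ones lie in
-- translates of {x, x^(2k+1)}.

module Submission where

open import Defs
open import Algebra.Bundles using (AbelianGroup; Group)
import Algebra.Properties.AbelianGroup as AbelianGroupProperties
import Algebra.Properties.Group as GroupProperties
open import Algebra.Structures using (IsAbelianGroup; IsGroup)
open import Data.Bool using (Bool; true; false; _∧_; not; T; T?; _xor_; if_then_else_)
open import Data.Bool.Properties
  using (∧-comm; ∧-assoc; ∧-identityʳ; ∧-zeroʳ; xor-assoc; xor-identityʳ; not-injective)
  renaming (_≟_ to _≟ᵇ_)
open import Data.Fin as Fin using (Fin; toℕ; join; splitAt)
open import Data.Fin.Patterns using (0F; 1F; 2F; 3F)
open import Data.Fin.Properties
  using (all?; toℕ-injective; toℕ-fromℕ<; toℕ<n; toℕ≤n; splitAt-join; join-splitAt)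
open import Data.List using (List; []; _∷_; _++_; map; filterᵇ; length; allFin; cartesianProduct)
open import Data.List.Membership.Propositional using (_∈_; lose)
open import Data.List.Membership.Propositional.Properties
  using (∈-map⁺; ∈-map⁻; ∈-++⁺ˡ; ∈-++⁺ʳ; ∈-++⁻; ∈-filter⁺; ∈-filter⁻; ∈-upTo⁺; ∈-allFin; ∈-cartesianProduct⁺)
open import Data.List.Membership.Propositional.Properties.WithK using (unique∧set⇒bag)
open import Data.List.Properties using (filter-++; length-++; filter-some; ++-identityʳ; length-tabulate)
open import Data.List.Relation.Binary.BagAndSetEquality using (∼bag⇒↭)
open import Data.List.Relation.Binary.Permutation.Propositional using (_↭_)
open import Data.List.Relation.Binary.Permutation.Propositional.Properties using (filter-↭; ↭-length)
open import Data.List.Relation.Unary.All as All using (All; []; _∷_)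
open import Data.List.Relation.Unary.AllPairs using ([]; _∷_)
open import Data.List.Relation.Unary.Any as Any using (here; there)
open import Data.List.Relation.Unary.Any.Properties using (any⁺; any⁻)
open import Data.List.Relation.Unary.Unique.Propositional using (Unique)
import Data.List.Relation.Unary.Unique.Propositional.Properties as Unique
open import Data.Nat using (ℕ; suc; _+_; _*_; _∸_; _≤_; _<_; z≤n; s≤s; NonZero; >-nonZero)
open import Data.Nat.DivMod
open import Data.Nat.Divisibility using (_∣_; m∣m*n; n∣m*n)
open import Data.Nat.Properties
  using ( suc-injective; +-assoc; +-comm; +-suc; +-identityʳ; +-cancelʳ-≡; m+n≡0⇒m≡0; m+[n∸m]≡n
        ; *-comm; *-cancelˡ-≡; *-cancelʳ-≡; *-monoˡ-≤; *-monoʳ-≤; *-monoˡ-<; m*n≢0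
        ; ≤-trans; ≤-reflexive; ≤-<-trans; <-trans; <⇒≤; <⇒≢; m≤m+n; m∸n≤m; m>n⇒m∸n≢0)
open import Data.Nat.Tactic.RingSolver using (solve-∀)
open import Data.Product using (∃; _×_; _,_; proj₁; proj₂; uncurry)
open import Data.Product.Properties using (,-injective; ,-injectiveʳ)
open import Data.Sum as Sum using (_⊎_; inj₁; inj₂; [_,_]′)
open import Data.Sum.Properties using (inj₁-injective; inj₂-injective)
open import Function using (_∘_; id; mk⇔)
open import Relation.Binary.Definitions using (DecidableEquality)
open import Relation.Binary.PropositionalEquality
open import Relation.Binary.PropositionalEquality.Properties using (isEquivalence)
open import Relation.Nullary using (¬_; Dec; yes; no; does; contradiction)
open import Relation.Nullary.Decidable using (dec-true; dec-false; does-⇔; map′; toWitness; _×-dec_)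

-- Counting in lists and in finite enumerations

private variable
  A A′ : Set

bool-ext : ∀ {a b} → (a ≡ true → b ≡ true) → (b ≡ true → a ≡ true) → a ≡ b
bool-ext {false} {false} f g = refl
bool-ext {false} {true}  f g = g refl
bool-ext {true}  {false} f g = sym (f refl)
bool-ext {true}  {true}  f g = refl

∧-true⁻ : ∀ a {b} → a ∧ b ≡ true → a ≡ true × b ≡ true
∧-true⁻ true eq = refl , eq

∧-true⁺ : ∀ {a b} → a ≡ true → b ≡ true → a ∧ b ≡ true
∧-true⁺ refl eq = eq

true⇒T : ∀ {b} → b ≡ true → T b
true⇒T refl = _

T⇒true : ∀ {b} → T b → b ≡ true
T⇒true {true} _ = refl

does-true⁻ : ∀ {P : Set} (P? : Dec P) → does P? ≡ true → P
does-true⁻ (yes p) _ = p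

# : (A → Bool) → List A → ℕ
# p xs = length (filterᵇ p xs)

𝟙 : Bool → ℕ
𝟙 false = 0
𝟙 true  = 1

𝟙-injective : ∀ {a b} → 𝟙 a ≡ 𝟙 b → a ≡ b
𝟙-injective {false} {false} _ = refl
𝟙-injective {true}  {true}  _ = refl

#-∷ : (p : A → Bool) (x : A) (xs : List A) → # p (x ∷ xs) ≡ 𝟙 (p x) + # p xs
#-∷ p x xs with p x
... | false = refl
... | true  = refl

#-cong : {p q : A → Bool} → p ≗ q → # p ≗ # q
#-cong p≗q [] = refl
#-cong {p = p} {q} p≗q (x ∷ xs) = begin
  # p (x ∷ xs)        ≡⟨ #-∷ p x xs ⟩
  𝟙 (p x) + # p xs    ≡⟨ cong₂ (λ b m → 𝟙 b + m) (p≗q x) (#-cong p≗q xs) ⟩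
  𝟙 (q x) + # q xs    ≡⟨ #-∷ q x xs ⟨
  # q (x ∷ xs)        ∎ where open ≡-Reasoning

#-++ : (p : A → Bool) (xs ys : List A) → # p (xs ++ ys) ≡ # p xs + # p ys
#-++ p xs ys = trans (cong length (filter-++ (T? ∘ p) xs ys)) (length-++ (filterᵇ p xs))

#-map : (p : A′ → Bool) (f : A → A′) (xs : List A) → # p (map f xs) ≡ # (p ∘ f) xs
#-map p f [] = refl
#-map p f (x ∷ xs) = begin
  # p (map f (x ∷ xs))           ≡⟨ #-∷ p (f x) (map f xs) ⟩
  𝟙 (p (f x)) + # p (map f xs)   ≡⟨ cong (𝟙 (p (f x)) +_) (#-map p f xs) ⟩
  𝟙 (p (f x)) + # (p ∘ f) xs     ≡⟨ #-∷ (p ∘ f) x xs ⟨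
  # (p ∘ f) (x ∷ xs)             ∎ where open ≡-Reasoning

#-none : {p : A → Bool} → (∀ x → p x ≡ false) → ∀ xs → # p xs ≡ 0
#-none p≗false [] = refl
#-none {p = p} p≗false (x ∷ xs) =
  trans (#-∷ p x xs) (cong₂ (λ b m → 𝟙 b + m) (p≗false x) (#-none p≗false xs))

#-all : {p : A → Bool} → (∀ x → p x ≡ true) → ∀ xs → # p xs ≡ length xs
#-all p≗true [] = refl
#-all {p = p} p≗true (x ∷ xs) =
  trans (#-∷ p x xs) (cong₂ (λ b m → 𝟙 b + m) (p≗true x) (#-all p≗true xs))

#-split : (p q : A → Bool) (xs : List A) →
          # p xs ≡ # (λ x → p x ∧ q x) xs + # (λ x → p x ∧ not (q x)) xs
#-split p q [] = refl
#-split p q (x ∷ xs) with p x | q x | #-split p q xs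
... | false | _     | ih = ih
... | true  | true  | ih = cong suc ih
... | true  | false | ih = trans (cong suc ih) (sym (+-suc _ _))

#-∃⁻ : (p : A → Bool) (xs : List A) → # p xs ≢ 0 → ∃ λ x → p x ≡ true
#-∃⁻ p [] ≢0 = contradiction refl ≢0
#-∃⁻ p (x ∷ xs) ≢0 with p x in eq
... | true  = x , eq
... | false = #-∃⁻ p xs ≢0

#-∃⁺ : (p : A → Bool) {x : A} {xs : List A} → x ∈ xs → p x ≡ true → # p xs ≢ 0
#-∃⁺ p x∈xs px #≡0 = <⇒≢ (filter-some (T? ∘ p) (lose x∈xs (true⇒T px))) (sym #≡0)

Enumerates : List A → Set
Enumerates xs = Unique xs × (∀ x → x ∈ xs)

#-bijection : {xs : List A} → Enumerates xs → (f g : A → A) →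
              (∀ x → g (f x) ≡ x) → (∀ x → f (g x) ≡ x) →
              ∀ p → # (p ∘ f) xs ≡ # p xs
#-bijection {xs = xs} (uniq , complete) f g gf fg p =
  trans (sym (#-map p f xs)) (↭-length (filter-↭ (T? ∘ p) map↭))
  where
  f-inj : ∀ {x y} → f x ≡ f y → x ≡ y
  f-inj {x} {y} eq = trans (sym (gf x)) (trans (cong g eq) (gf y))
  -- `map f xs` and `xs` have no repetitions and the same members, so they agree as bags.
  map↭ : map f xs ↭ xs
  map↭ = ∼bag⇒↭ (unique∧set⇒bag (Unique.map⁺ f-inj uniq) uniq
    λ {y} → mk⇔ (λ _ → complete y) (λ _ → subst (_∈ map f xs) (fg y) (∈-map⁺ f (complete (g y)))))

module _ (_≟_ : DecidableEquality A) where

  #-≟ : {xs : List A} → Enumerates xs → (p : A → Bool) (y : A) →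
        # (λ x → p x ∧ does (x ≟ y)) xs ≡ 𝟙 (p y)
  #-≟ (uniq , complete) p y = go uniq (complete y)
    where
    q : A → Bool
    q x = p x ∧ does (x ≟ y)
    absent : ∀ {xs} → All (y ≢_) xs → # q xs ≡ 0
    absent [] = refl
    absent {x ∷ xs} (y≢x ∷ y∉xs) = trans (#-∷ q x xs)
      (cong₂ (λ b m → 𝟙 b + m)
        (trans (cong (p x ∧_) (dec-false (x ≟ y) (≢-sym y≢x))) (∧-zeroʳ (p x)))
        (absent y∉xs))
    go : ∀ {xs} → Unique xs → y ∈ xs → # q xs ≡ 𝟙 (p y)
    go {x ∷ xs} (x∉xs ∷ _) (here refl) = trans (#-∷ q x xs)
      (trans (cong₂ (λ b m → 𝟙 b + m)
        (trans (cong (p x ∧_) (dec-true (x ≟ x) refl)) (∧-identityʳ (p x)))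
        (absent x∉xs)) (+-identityʳ _))
    go {x ∷ xs} (x∉xs ∷ uniq) (there y∈xs) = trans (#-∷ q x xs)
      (cong₂ (λ b m → 𝟙 b + m)
        (trans (cong (p x ∧_) (dec-false (x ≟ y) x≢y)) (∧-zeroʳ (p x)))
        (go uniq y∈xs))
      where
      x≢y : x ≢ y
      x≢y refl = All.lookup x∉xs y∈xs refl

  #-fibrewise : (cs : List A) (xs : List A′) (f g : A′ → A) →
                (∀ c → # (λ x → does (f x ≟ c)) xs ≡ # (λ x → does (g x ≟ c)) xs) →
                (P : A → Bool) → (∀ c → P c ≡ true → c ∈ cs) →
                # (P ∘ f) xs ≡ # (P ∘ g) xs
  #-fibrewise [] xs f g eq P supp =
    trans (#-none (λ x → vanish (f x)) xs) (sym (#-none (λ x → vanish (g x)) xs))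
    where
    vanish : ∀ c → P c ≡ false
    vanish c with P c in Pc
    ... | false = refl
    ... | true with () ← supp c Pc
  #-fibrewise {A′ = A′} (c ∷ cs) xs f g eq P supp = begin
    # (P ∘ f) xs                              ≡⟨ #-split (P ∘ f) (λ x → does (f x ≟ c)) xs ⟩
    # (at f) xs + # (Q ∘ f) xs                ≡⟨ cong₂ _+_ at-eq (#-fibrewise cs xs f g eq Q Q-supp) ⟩
    # (at g) xs + # (Q ∘ g) xs                ≡⟨ #-split (P ∘ g) (λ x → does (g x ≟ c)) xs ⟨
    # (P ∘ g) xs                              ∎
    where
    open ≡-Reasoning
    -- The induction removes one value `c` of the support at a time. On the fibre over `c` the
    -- predicate `P` is constant, so the hypothesis on fibre sizes compares the two counts; `Q` is
    -- `P` with `c` deleted and is supported on `cs`.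
    Q : A → Bool
    Q d = P d ∧ not (does (d ≟ c))
    at : (A′ → A) → A′ → Bool
    at h x = P (h x) ∧ does (h x ≟ c)
    Q-supp : ∀ d → Q d ≡ true → d ∈ cs
    Q-supp d Qd with d ≟ c | ∧-true⁻ (P d) Qd
    ... | yes _  | _ , ()
    ... | no d≢c | Pd , _ with supp d Pd
    ... | here d≡c   = contradiction d≡c d≢c
    ... | there d∈cs = d∈cs
    at-P : ∀ h x → at h x ≡ P c ∧ does (h x ≟ c)
    at-P h x with h x ≟ c
    ... | yes hx≡c = cong (λ d → P d ∧ true) hx≡c
    ... | no _     = trans (∧-zeroʳ (P (h x))) (sym (∧-zeroʳ (P c)))
    at-eq : # (at f) xs ≡ # (at g) xs
    at-eq with P c | at-P
    ... | true  | at-P′ = trans (#-cong (at-P′ f) xs) (trans (eq c) (sym (#-cong (at-P′ g) xs)))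
    ... | false | at-P′ = trans (#-none (at-P′ f) xs) (sym (#-none (at-P′ g) xs))

-- ℤ/n and the dihedral group

allFin-enumerates : ∀ n → Enumerates (allFin n)
allFin-enumerates n = Unique.allFin⁺ n , ∈-allFin

module DihedralGroup (n : ℕ) .{{_ : NonZero n}} where
  open Dihedral n

  toℕ-xexp : ∀ a → toℕ (xexp a) ≡ a % n
  toℕ-xexp a = toℕ-fromℕ< _

  xexp-cong : ∀ {a b} → a % n ≡ b % n → xexp a ≡ xexp b
  xexp-cong {a} {b} eq = toℕ-injective (trans (toℕ-xexp a) (trans eq (sym (toℕ-xexp b))))

  xexp-toℕ : ∀ i → xexp (toℕ i) ≡ i
  xexp-toℕ i = toℕ-injective (trans (toℕ-xexp (toℕ i)) (m<n⇒m%n≡m (toℕ<n i)))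

  xexp-+ : ∀ a b → addₓ (xexp a) (xexp b) ≡ xexp (a + b)
  xexp-+ a b = xexp-cong (trans (cong₂ (λ c d → (c + d) % n) (toℕ-xexp a) (toℕ-xexp b))
                                (sym (%-distribˡ-+ a b n)))

  xexp-n : xexp n ≡ xexp 0
  xexp-n = xexp-cong (trans (n%n≡0 n) (sym (m*n%n≡0 0 n)))

  addₓ-assoc : ∀ i j l → addₓ (addₓ i j) l ≡ addₓ i (addₓ j l)
  addₓ-assoc i j l = begin
    addₓ (addₓ i j) l                    ≡⟨ cong (addₓ (addₓ i j)) (xexp-toℕ l) ⟨
    addₓ (addₓ i j) (xexp (toℕ l))       ≡⟨ xexp-+ (toℕ i + toℕ j) (toℕ l) ⟩
    xexp (toℕ i + toℕ j + toℕ l)         ≡⟨ cong xexp (+-assoc (toℕ i) (toℕ j) (toℕ l)) ⟩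
    xexp (toℕ i + (toℕ j + toℕ l))       ≡⟨ xexp-+ (toℕ i) (toℕ j + toℕ l) ⟨
    addₓ (xexp (toℕ i)) (addₓ j l)       ≡⟨ cong (λ m → addₓ m (addₓ j l)) (xexp-toℕ i) ⟩
    addₓ i (addₓ j l)                    ∎ where open ≡-Reasoning

  addₓ-comm : ∀ i j → addₓ i j ≡ addₓ j i
  addₓ-comm i j = cong xexp (+-comm (toℕ i) (toℕ j))

  addₓ-identityˡ : ∀ i → addₓ (xexp 0) i ≡ i
  addₓ-identityˡ i = begin
    addₓ (xexp 0) i                 ≡⟨ cong (addₓ (xexp 0)) (xexp-toℕ i) ⟨
    addₓ (xexp 0) (xexp (toℕ i))    ≡⟨ xexp-+ 0 (toℕ i) ⟩
    xexp (toℕ i)                    ≡⟨ xexp-toℕ i ⟩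
    i                               ∎ where open ≡-Reasoning

  addₓ-inverseʳ : ∀ i → addₓ i (negₓ i) ≡ xexp 0
  addₓ-inverseʳ i = begin
    addₓ i (negₓ i)                    ≡⟨ cong (λ j → addₓ j (negₓ i)) (xexp-toℕ i) ⟨
    addₓ (xexp (toℕ i)) (negₓ i)       ≡⟨ xexp-+ (toℕ i) (n ∸ toℕ i) ⟩
    xexp (toℕ i + (n ∸ toℕ i))         ≡⟨ cong xexp (m+[n∸m]≡n (toℕ≤n i)) ⟩
    xexp n                             ≡⟨ xexp-n ⟩
    xexp 0                             ∎ where open ≡-Reasoning

  addₓ-isAbelianGroup : IsAbelianGroup _≡_ addₓ (xexp 0) negₓ
  addₓ-isAbelianGroup = record
    { isGroup = record
      { isMonoid = record
        { isSemigroup = record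
          { isMagma = record { isEquivalence = isEquivalence ; ∙-cong = cong₂ addₓ }
          ; assoc   = addₓ-assoc
          }
        ; identity = addₓ-identityˡ , λ i → trans (addₓ-comm i (xexp 0)) (addₓ-identityˡ i)
        }
      ; inverse = (λ i → trans (addₓ-comm (negₓ i) i) (addₓ-inverseʳ i)) , addₓ-inverseʳ
      ; ⁻¹-cong = cong negₓ
      }
    ; comm = addₓ-comm
    }

  ℤₙ : AbelianGroup _ _
  ℤₙ = record { isAbelianGroup = addₓ-isAbelianGroup }

  open AbelianGroup ℤₙ using () renaming
    (identityʳ to addₓ-identityʳ; inverseˡ to addₓ-inverseˡ) public
  open AbelianGroupProperties ℤₙ using () renaming
    ( ⁻¹-involutive to negₓ-involutive; ε⁻¹≈ε to negₓ-zero; ⁻¹-∙-comm to negₓ-addₓ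
    ; ∙-cancelˡ to addₓ-cancelˡ; ∙-cancelʳ to addₓ-cancelʳ
    ; inverseˡ-unique to addₓ-inverseˡ-unique) public

  ·-assoc : ∀ g h k → (g · h) · k ≡ g · (h · k)
  ·-assoc (a , i) (c , j) (d , l) = cong₂ _,_ (xor-assoc a c d) (exponent c d)
    where
    exponent : ∀ c d →
      addₓ (if d then negₓ (addₓ (if c then negₓ i else i) j) else addₓ (if c then negₓ i else i) j) l
      ≡ addₓ (if c xor d then negₓ i else i) (addₓ (if d then negₓ j else j) l)
    exponent false false = addₓ-assoc _ _ _
    exponent true  false = addₓ-assoc _ _ _
    exponent false true  = trans (cong (λ m → addₓ m l) (sym (negₓ-addₓ i j))) (addₓ-assoc _ _ _)
    exponent true  true  = trans (cong (λ m → addₓ m l)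
      (trans (sym (negₓ-addₓ (negₓ i) j)) (cong (λ m → addₓ m (negₓ j)) (negₓ-involutive i)))) (addₓ-assoc _ _ _)

  ·-identityˡ : ∀ g → e · g ≡ g
  ·-identityˡ (false , j) = cong (false ,_) (addₓ-identityˡ j)
  ·-identityˡ (true  , j) = cong (true ,_) (trans (cong (λ m → addₓ m j) negₓ-zero) (addₓ-identityˡ j))

  ·-identityʳ : ∀ g → g · e ≡ g
  ·-identityʳ (a , i) = cong₂ _,_ (xor-identityʳ a) (addₓ-identityʳ i)

  ·-inverseˡ : ∀ g → inv g · g ≡ e
  ·-inverseˡ (false , i) = cong (false ,_) (addₓ-inverseˡ i)
  ·-inverseˡ (true  , i) = cong (false ,_) (addₓ-inverseˡ i)

  ·-inverseʳ : ∀ g → g · inv g ≡ e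
  ·-inverseʳ (false , i) = cong (false ,_) (addₓ-inverseʳ i)
  ·-inverseʳ (true  , i) = cong (false ,_) (addₓ-inverseˡ i)

  ·-isGroup : IsGroup _≡_ _·_ e inv
  ·-isGroup = record
    { isMonoid = record
      { isSemigroup = record
        { isMagma = record { isEquivalence = isEquivalence ; ∙-cong = cong₂ _·_ }
        ; assoc   = ·-assoc
        }
      ; identity = ·-identityˡ , ·-identityʳ
      }
    ; inverse = ·-inverseˡ , ·-inverseʳ
    ; ⁻¹-cong = cong inv
    }

  Dₙ : Group _ _
  Dₙ = record { isGroup = ·-isGroup }

  open GroupProperties Dₙ using () renaming
    ( ⁻¹-involutive to inv-involutive; ⁻¹-anti-homo-∙ to inv-·
    ; ∙-cancelʳ to ·-cancelʳ) public

  inv-cancelˡ : ∀ g h → inv g · (g · h) ≡ h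
  inv-cancelˡ g h = trans (sym (·-assoc (inv g) g h)) (trans (cong (_· h) (·-inverseˡ g)) (·-identityˡ h))

  inv-cancelʳ : ∀ g h → g · (inv g · h) ≡ h
  inv-cancelʳ g h = trans (sym (·-assoc g (inv g) h)) (trans (cong (_· h) (·-inverseʳ g)) (·-identityˡ h))

  elements-enumerates : Enumerates elements
  elements-enumerates =
    Unique.cartesianProduct⁺ {xs = false ∷ true ∷ []} (((λ ()) ∷ []) ∷ [] ∷ []) (Unique.allFin⁺ n) ,
    λ { (false , i) → ∈-cartesianProduct⁺ {xs = false ∷ true ∷ []} (here refl) (∈-allFin i)
      ; (true  , i) → ∈-cartesianProduct⁺ {xs = false ∷ true ∷ []} (there (here refl)) (∈-allFin i) }

  count-rotations+reflections : ∀ p →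
    count p ≡ # (λ i → p (false , i)) (allFin n) + # (λ i → p (true , i)) (allFin n)
  count-rotations+reflections p = begin
    # p (map (false ,_) (allFin n) ++ map (true ,_) (allFin n) ++ [])
      ≡⟨ cong (λ xs → # p (map (false ,_) (allFin n) ++ xs)) (++-identityʳ (map (true ,_) (allFin n))) ⟩
    # p (map (false ,_) (allFin n) ++ map (true ,_) (allFin n))
      ≡⟨ #-++ p (map (false ,_) (allFin n)) _ ⟩
    # p (map (false ,_) (allFin n)) + # p (map (true ,_) (allFin n))
      ≡⟨ cong₂ _+_ (#-map p _ (allFin n)) (#-map p _ (allFin n)) ⟩
    # (λ i → p (false , i)) (allFin n) + # (λ i → p (true , i)) (allFin n) ∎
    where open ≡-Reasoning

-- S-rings over dihedral groups

module CayleyCounts (n : ℕ) .{{_ : NonZero n}} (S : Dihedral.Elt n → Bool) where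
  open Dihedral n
  open DihedralGroup n
  open FinGraph elements (CayAdj S) using (common)

  factorisations : Elt → ℕ
  factorisations z = count (λ a → S a ∧ S (inv a · z))

  -- Put a = vw⁻¹ for a common neighbour w of u and v. Then a⁻¹(vu⁻¹) = wu⁻¹, so the two adjacency
  -- conditions become the two membership conditions of a factorisation.
  common-factorisations : ∀ u v → common u v ≡ factorisations (v · inv u)
  common-factorisations u v = trans (#-cong substituted elements)
    (#-bijection elements-enumerates (λ w → v · inv w) (λ a → inv a · v) to-from from-to
                 (λ a → S a ∧ S (inv a · (v · inv u))))
    where
    inv-v·inv-w : ∀ w → inv (v · inv w) ≡ w · inv v
    inv-v·inv-w w = trans (inv-· v (inv w)) (cong (_· inv v) (inv-involutive w))
    to-from : ∀ w → inv (v · inv w) · v ≡ w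
    to-from w = trans (cong (_· v) (inv-v·inv-w w)) (trans (·-assoc w (inv v) v)
      (trans (cong (w ·_) (·-inverseˡ v)) (·-identityʳ w)))
    from-to : ∀ a → v · inv (inv a · v) ≡ a
    from-to a = begin
      v · inv (inv a · v)       ≡⟨ cong (v ·_) (inv-· (inv a) v) ⟩
      v · (inv v · inv (inv a)) ≡⟨ inv-cancelʳ v _ ⟩
      inv (inv a)               ≡⟨ inv-involutive a ⟩
      a                         ∎ where open ≡-Reasoning
    substituted : ∀ w → S (w · inv u) ∧ S (v · inv w) ≡
                        S (v · inv w) ∧ S (inv (v · inv w) · (v · inv u))
    substituted w = trans (∧-comm (S (w · inv u)) _) (cong (λ h → S (v · inv w) ∧ S h) (sym
      (trans (sym (·-assoc (inv (v · inv w)) v (inv u))) (cong (_· inv u) (to-from w)))))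

  Cay-regular : ∀ v → count (CayAdj S v) ≡ count S
  Cay-regular v = #-bijection elements-enumerates (_· inv v) (_· v)
    (λ w → trans (·-assoc w (inv v) v) (trans (cong (w ·_) (·-inverseˡ v)) (·-identityʳ w)))
    (λ w → trans (·-assoc w v (inv v)) (trans (cong (w ·_) (·-inverseʳ v)) (·-identityʳ w)))
    S

module SRingProperties (n : ℕ) .{{_ : NonZero n}} {r : ℕ}
  (c : Dihedral.Elt n → Fin r) (isSRing : Dihedral.IsSRing n c) where
  open Dihedral n
  open DihedralGroup n

  infix 4 _~_
  _~_ : Elt → Elt → Set
  g ~ h = c g ≡ c h

  Singleton : Elt → Set
  Singleton g = ∀ h → h ~ g → h ≡ g

  private
    colour-surjective : ∀ i → ∃ λ g → c g ≡ i
    colour-surjective = proj₁ isSRing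
    coeff-constant : ∀ i j z z′ → z ~ z′ → coeff c i j z ≡ coeff c i j z′
    coeff-constant = proj₂ (proj₂ (proj₂ isSRing))

  ~-inv : ∀ {g h} → g ~ h → inv g ~ inv h
  ~-inv = proj₁ (proj₂ (proj₂ isSRing)) _ _

  -- The structure constant for the basic sets of `a` and `inv a · z` is positive at `z`, as `a`
  -- itself is counted there; being constant on basic sets, it is positive at `z′`. Apart from the
  -- numbers of factorisations, structure constants enter the minimality argument only in this form.
  ~-factor : ∀ {z z′} → z ~ z′ → ∀ a → ∃ λ a′ → a′ ~ a × inv a′ · z′ ~ inv a · z
  ~-factor {z} {z′} z~z′ a =
    a′ , does-true⁻ (c a′ Fin.≟ _) (proj₁ matches) , does-true⁻ (c (inv a′ · z′) Fin.≟ _) (proj₂ matches)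
    where
    coeff≢0 : coeff c (c a) (c (inv a · z)) z ≢ 0
    coeff≢0 = #-∃⁺ _ (proj₂ elements-enumerates a)
      (∧-true⁺ (dec-true (c a Fin.≟ c a) refl) (dec-true (c (inv a · z) Fin.≟ c (inv a · z)) refl))
    witness : ∃ λ b → does (c b Fin.≟ c a) ∧ does (c (inv b · z′) Fin.≟ c (inv a · z)) ≡ true
    witness = #-∃⁻ _ elements (subst (_≢ 0) (coeff-constant _ _ z z′ z~z′) coeff≢0)
    a′ = proj₁ witness
    matches = ∧-true⁻ (does (c a′ Fin.≟ c a)) (proj₂ witness)

  singleton-e : Singleton e
  singleton-e = proj₁ (proj₂ isSRing)

  singleton-inv : ∀ {g} → Singleton g → Singleton (inv g)
  singleton-inv {g} sing h h~inv-g = trans (sym (inv-involutive h)) (cong inv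
    (sing (inv h) (trans (~-inv h~inv-g) (cong c (inv-involutive g)))))

  -- If `{g}` is basic, the left factor that `~-factor` supplies for `z′` can only be `g`.
  ~-cancelˡ : ∀ {g} → Singleton g → ∀ {z z′} → z ~ z′ → inv g · z ~ inv g · z′
  ~-cancelˡ {g} sing {z} {z′} z~z′ with ~-factor z~z′ g
  ... | a′ , a′~g , eq with refl ← sing a′ a′~g = sym eq

  -- Here the singleton is the right factor: z = (zg⁻¹)g, and the cofactor found for `z′` is forced
  -- to be `g`, so the left factor is z′g⁻¹.
  ~-cancelʳ : ∀ {g} → Singleton g → ∀ {z z′} → z ~ z′ → z · inv g ~ z′ · inv g
  ~-cancelʳ {g} sing {z} {z′} z~z′ with ~-factor z~z′ (z · inv g)
  ... | a′ , a′~ , eq = trans (sym a′~) (cong c a′≡)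
    where
    a⁻¹z≡g : inv (z · inv g) · z ≡ g
    a⁻¹z≡g = begin
      inv (z · inv g) · z         ≡⟨ cong (_· z) (inv-· z (inv g)) ⟩
      (inv (inv g) · inv z) · z   ≡⟨ ·-assoc (inv (inv g)) (inv z) z ⟩
      inv (inv g) · (inv z · z)   ≡⟨ cong₂ _·_ (inv-involutive g) (·-inverseˡ z) ⟩
      g · e                       ≡⟨ ·-identityʳ g ⟩
      g                           ∎ where open ≡-Reasoning
    a′⁻¹z′≡g : inv a′ · z′ ≡ g
    a′⁻¹z′≡g = sing _ (trans eq (cong c a⁻¹z≡g))
    a′≡ : a′ ≡ z′ · inv g
    a′≡ = begin
      a′                          ≡⟨ ·-identityʳ a′ ⟨
      a′ · e                      ≡⟨ cong (a′ ·_) (·-inverseʳ g) ⟨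
      a′ · (g · inv g)            ≡⟨ cong (λ h → a′ · (h · inv g)) a′⁻¹z′≡g ⟨
      a′ · ((inv a′ · z′) · inv g) ≡⟨ ·-assoc a′ _ (inv g) ⟨
      (a′ · (inv a′ · z′)) · inv g ≡⟨ cong (_· inv g) (inv-cancelʳ a′ z′) ⟩
      z′ · inv g                  ∎ where open ≡-Reasoning

  singleton-· : ∀ {g h} → Singleton g → Singleton h → Singleton (g · h)
  singleton-· {g} {h} sing-g sing-h z z~gh = begin
    z                  ≡⟨ inv-cancelʳ g z ⟨
    g · (inv g · z)    ≡⟨ cong (g ·_) (sing-h _ (trans (~-cancelˡ sing-g z~gh) (cong c (inv-cancelˡ g h)))) ⟩
    g · h              ∎ where open ≡-Reasoning

  module _ {S : Elt → Bool} (union : IsUnionOfBasic S c) where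

    -- The number of factorisations is the sum of the structure constants over all pairs of basic
    -- sets contained in `S`, so it inherits their constancy. `S̄` is `S` read off from colours
    -- through representatives, which is legitimate because `S` is a union of basic sets.
    count-factorisations-~ : ∀ {z z′} → z ~ z′ →
      count (λ a → S a ∧ S (inv a · z)) ≡ count (λ a → S a ∧ S (inv a · z′))
    count-factorisations-~ {z} {z′} z~z′ =
      trans (sym (#-cong (Q∘colours z) elements))
        (trans (#-fibrewise _≟²_ colours elements (factor z) (factor z′)
                 (λ (i , j) → coeff-constant i j z z′ z~z′)
                 Q (λ (i , j) _ → ∈-cartesianProduct⁺ (∈-allFin i) (∈-allFin j)))
               (#-cong (Q∘colours z′) elements))
      where
      colours : List (Fin r × Fin r)
      colours = cartesianProduct (allFin r) (allFin r)
      _≟²_ : DecidableEquality (Fin r × Fin r)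
      (i , j) ≟² (i′ , j′) =
        map′ (uncurry (cong₂ _,_)) ,-injective ((i Fin.≟ i′) ×-dec (j Fin.≟ j′))
      factor : Elt → Elt → Fin r × Fin r
      factor z a = c a , c (inv a · z)
      S̄ : Fin r → Bool
      S̄ i = S (proj₁ (colour-surjective i))
      S̄∘c : ∀ g → S̄ (c g) ≡ S g
      S̄∘c g = union _ g (proj₂ (colour-surjective (c g)))
      Q : Fin r × Fin r → Bool
      Q (i , j) = S̄ i ∧ S̄ j
      Q∘colours : ∀ z a → Q (factor z a) ≡ S a ∧ S (inv a · z)
      Q∘colours z a = cong₂ _∧_ (S̄∘c a) (S̄∘c (inv a · z))

-- The connection set, with exponents classified modulo 4

open Dihedral 4 using () renaming (addₓ to infixl 6 _+₄_; negₓ to -₄_)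

-- S is x²A₁ ∪ yB.  The parameters p, o, ℓ stand for the exponents 2k − 2, −1, 2k of x, so that
-- q = −2 and o′ = 2k − 1; the exponent set B is A₁ without p together with one element of each
-- of the other three classes modulo 4.
module ResidueSet (n : ℕ) .{{_ : NonZero n}}
  (cls : Fin n → Fin 4)
  (cls-addₓ : ∀ i j → cls (Dihedral.addₓ n i j) ≡ cls i +₄ cls j)
  (p o ℓ : Fin n)
  (cls-p : cls p ≡ 0F) (cls-o : cls o ≡ 3F) (cls-ℓ : cls ℓ ≡ 2F)
  (ℓ-order : Dihedral.addₓ n ℓ ℓ ≡ Dihedral.xexp n 0)
  where
  open Dihedral n renaming (addₓ to infixl 6 _⊕_; negₓ to ⊖_)
  open DihedralGroup n

  infix 4 _==_
  _==_ : Fin n → Fin n → Bool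
  i == j = does (i Fin.≟ j)

  _∈ᶜ_ : Fin n → Fin 4 → Bool
  i ∈ᶜ j = does (cls i Fin.≟ j)

  q o′ : Fin n
  q  = p ⊕ ℓ
  o′ = o ⊕ ℓ

  Bᶜ : Fin 4 → Fin n → Bool
  Bᶜ 0F i = not (i == p)
  Bᶜ 1F i = i == o′
  Bᶜ 2F i = i == q
  Bᶜ 3F i = i == o

  B : Fin n → Bool
  B i = Bᶜ (cls i) i

  S : Elt → Bool
  S (false , i) = i ∈ᶜ 2F
  S (true  , i) = B i

  open CayleyCounts n S public

  cls-0 : cls (xexp 0) ≡ 0F
  cls-0 = trans (sym (cong cls ℓ-order)) (trans (cls-addₓ ℓ ℓ) (cong₂ _+₄_ cls-ℓ cls-ℓ))

  cls-neg : ∀ i → cls (⊖ i) ≡ -₄ (cls i)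
  cls-neg i = DihedralGroup.addₓ-inverseˡ-unique 4 (cls (⊖ i)) (cls i)
    (trans (sym (cls-addₓ (⊖ i) i)) (trans (cong cls (addₓ-inverseˡ i)) cls-0))

  cls-q : cls q ≡ 2F
  cls-q = trans (cls-addₓ p ℓ) (cong₂ _+₄_ cls-p cls-ℓ)

  cls-o′ : cls o′ ≡ 1F
  cls-o′ = trans (cls-addₓ o ℓ) (cong₂ _+₄_ cls-o cls-ℓ)

  cls-⊕ : ∀ {a m i j} → cls a ≡ i → cls m ≡ j → cls (a ⊕ m) ≡ i +₄ j
  cls-⊕ cls-a cls-m = trans (cls-addₓ _ _) (cong₂ _+₄_ cls-a cls-m)

  cls-⊖⊕ : ∀ {a m i j} → cls a ≡ i → cls m ≡ j → cls (⊖ a ⊕ m) ≡ (-₄ i) +₄ j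
  cls-⊖⊕ cls-a cls-m = cls-⊕ (trans (cls-neg _) (cong -₄_ cls-a)) cls-m

  ⊕ℓ⊕ℓ : ∀ i → i ⊕ ℓ ⊕ ℓ ≡ i
  ⊕ℓ⊕ℓ i = trans (addₓ-assoc i ℓ ℓ) (trans (cong (i ⊕_) ℓ-order) (addₓ-identityʳ i))

  ⊕-swap : ∀ i j l → i ⊕ j ⊕ l ≡ i ⊕ l ⊕ j
  ⊕-swap i j l = trans (addₓ-assoc i j l) (trans (cong (i ⊕_) (addₓ-comm j l)) (sym (addₓ-assoc i l j)))

  ==-shift : ∀ i j m → ((i ⊕ ℓ) ⊕ m == j ⊕ ℓ) ≡ (i ⊕ m == j)
  ==-shift i j m = does-⇔ (mk⇔
    (λ eq → addₓ-cancelʳ ℓ _ _ (trans (⊕-swap i m ℓ) eq))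
    (λ eq → trans (⊕-swap i ℓ m) (cong (_⊕ ℓ) eq)))
    (_ Fin.≟ _) (_ Fin.≟ _)

  -- As ℓ = -ℓ, it can change sides. Together with `==-shift` this leaves at most two independent
  -- tests among the four that occur in an autocorrelation outside A₁.
  ==-flip : ∀ i j m → (i ⊕ m == j ⊕ ℓ) ≡ ((i ⊕ ℓ) ⊕ m == j)
  ==-flip i j m = trans (sym (==-shift i (j ⊕ ℓ) m)) (cong ((i ⊕ ℓ) ⊕ m ==_) (⊕ℓ⊕ℓ j))

  ==-cancelˡ : ∀ i j m → (i ⊕ m == i ⊕ j) ≡ (m == j)
  ==-cancelˡ i j m = does-⇔ (mk⇔ (addₓ-cancelˡ i _ _) (cong (i ⊕_))) (_ Fin.≟ _) (_ Fin.≟ _)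

  B-at : ∀ {i j} → cls i ≡ j → B i ≡ Bᶜ j i
  B-at refl = refl

  private
    #ₙ : (Fin n → Bool) → ℕ
    #ₙ f = # f (allFin n)

  #-classes : ∀ (f : Fin n → Bool) → #ₙ f ≡ #ₙ (λ i → f i ∧ i ∈ᶜ 0F) + #ₙ (λ i → f i ∧ i ∈ᶜ 1F)
                         + #ₙ (λ i → f i ∧ i ∈ᶜ 2F) + #ₙ (λ i → f i ∧ i ∈ᶜ 3F)
  #-classes f = begin
    #ₙ f
      ≡⟨ #-split f (_∈ᶜ 0F) (allFin n) ⟩
    s 0F + #ₙ f₀
      ≡⟨ cong (s 0F +_) (trans (#-split f₀ (_∈ᶜ 1F) (allFin n)) (cong₂ _+_ (#-cong c₁ (allFin n))
           (trans (#-split f₁ (_∈ᶜ 2F) (allFin n)) (cong₂ _+_ (#-cong c₂ (allFin n)) (#-cong c₃ (allFin n)))))) ⟩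
    s 0F + (s 1F + (s 2F + s 3F))
      ≡⟨ reassoc (s 0F) (s 1F) (s 2F) (s 3F) ⟩
    s 0F + s 1F + s 2F + s 3F ∎
    where
    open ≡-Reasoning
    s : Fin 4 → ℕ
    s j = #ₙ (λ i → f i ∧ i ∈ᶜ j)
    f₀ f₁ : Fin n → Bool
    f₀ i = f i ∧ not (i ∈ᶜ 0F)
    f₁ i = f₀ i ∧ not (i ∈ᶜ 1F)
    c₁ : ∀ i → f₀ i ∧ i ∈ᶜ 1F ≡ f i ∧ i ∈ᶜ 1F
    c₁ i with f i | cls i
    ... | false | _  = refl
    ... | true  | 0F = refl
    ... | true  | 1F = refl
    ... | true  | 2F = refl
    ... | true  | 3F = refl
    c₂ : ∀ i → f₁ i ∧ i ∈ᶜ 2F ≡ f i ∧ i ∈ᶜ 2F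
    c₂ i with f i | cls i
    ... | false | _  = refl
    ... | true  | 0F = refl
    ... | true  | 1F = refl
    ... | true  | 2F = refl
    ... | true  | 3F = refl
    c₃ : ∀ i → f₁ i ∧ not (i ∈ᶜ 2F) ≡ f i ∧ i ∈ᶜ 3F
    c₃ i with f i | cls i
    ... | false | _  = refl
    ... | true  | 0F = refl
    ... | true  | 1F = refl
    ... | true  | 2F = refl
    ... | true  | 3F = refl
    reassoc : ∀ a b c d → a + (b + (c + d)) ≡ a + b + c + d
    reassoc = solve-∀

  #-translate : ∀ j (f : Fin n → Bool) → #ₙ (λ i → f (i ⊕ j)) ≡ #ₙ f
  #-translate j f = #-bijection (allFin-enumerates n) (_⊕ j) (_⊕ (⊖ j))
    (λ i → trans (addₓ-assoc i j (⊖ j)) (trans (cong (i ⊕_) (addₓ-inverseʳ j)) (addₓ-identityʳ i)))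
    (λ i → trans (addₓ-assoc i (⊖ j) j) (trans (cong (i ⊕_) (addₓ-inverseˡ j)) (addₓ-identityʳ i)))
    f

  B-class : ∀ (g : Fin n → Bool) i {j} → (B i ∧ g i) ∧ i ∈ᶜ j ≡ (g i ∧ Bᶜ j i) ∧ i ∈ᶜ j
  B-class g i {j} with cls i Fin.≟ j
  ... | yes refl = cong (_∧ true) (∧-comm (B i) (g i))
  ... | no _     = trans (∧-zeroʳ _) (sym (∧-zeroʳ _))

  ==-∈ᶜ : ∀ {a j} → cls a ≡ j → ∀ (g : Fin n → Bool) i → (g i ∧ (i == a)) ∧ i ∈ᶜ j ≡ g i ∧ (i == a)
  ==-∈ᶜ {a} refl g i with i Fin.≟ a
  ... | yes refl = trans (cong ((g i ∧ true) ∧_) (dec-true (cls i Fin.≟ cls i) refl)) (∧-identityʳ _)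
  ... | no _     = trans (cong (_∧ i ∈ᶜ cls a) (∧-zeroʳ (g i))) (sym (∧-zeroʳ (g i)))

  #-B-point : ∀ (g : Fin n → Bool) {a j} → cls a ≡ j → (∀ i → Bᶜ j i ≡ (i == a)) →
              #ₙ (λ i → (B i ∧ g i) ∧ i ∈ᶜ j) ≡ 𝟙 (g a)
  #-B-point g {a} {j} cls-a Bᶜ-j = trans
    (#-cong (λ i → trans (B-class g i) (trans (cong (λ b → (g i ∧ b) ∧ i ∈ᶜ j) (Bᶜ-j i)) (==-∈ᶜ cls-a g i))) (allFin n))
    (#-≟ Fin._≟_ (allFin-enumerates n) g a)

  #-B-class₀ : ∀ (g : Fin n → Bool) → #ₙ (λ i → (B i ∧ g i) ∧ i ∈ᶜ 0F) + 𝟙 (g p) ≡ #ₙ (λ i → i ∈ᶜ 0F ∧ g i)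
  #-B-class₀ g = begin
    #ₙ (λ i → (B i ∧ g i) ∧ i ∈ᶜ 0F) + 𝟙 (g p)
      ≡⟨ +-comm _ (𝟙 (g p)) ⟩
    𝟙 (g p) + #ₙ (λ i → (B i ∧ g i) ∧ i ∈ᶜ 0F)
      ≡⟨ cong₂ _+_ (sym at-p) (#-cong off-p (allFin n)) ⟩
    #ₙ (λ i → (i ∈ᶜ 0F ∧ g i) ∧ (i == p)) + #ₙ (λ i → (i ∈ᶜ 0F ∧ g i) ∧ not (i == p))
      ≡⟨ #-split (λ i → i ∈ᶜ 0F ∧ g i) (_== p) (allFin n) ⟨
    #ₙ (λ i → i ∈ᶜ 0F ∧ g i) ∎
    where
    open ≡-Reasoning
    at-p : #ₙ (λ i → (i ∈ᶜ 0F ∧ g i) ∧ (i == p)) ≡ 𝟙 (g p)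
    at-p = trans (#-≟ Fin._≟_ (allFin-enumerates n) (λ i → i ∈ᶜ 0F ∧ g i) p)
                 (cong (λ b → 𝟙 (b ∧ g p)) (dec-true (cls p Fin.≟ 0F) cls-p))
    off-p : ∀ i → (B i ∧ g i) ∧ i ∈ᶜ 0F ≡ (i ∈ᶜ 0F ∧ g i) ∧ not (i == p)
    off-p i = trans (B-class g i) (trans (∧-comm (g i ∧ _) (i ∈ᶜ 0F)) (sym (∧-assoc (i ∈ᶜ 0F) (g i) _)))

  #-B : ∀ (g : Fin n → Bool) → #ₙ (λ i → B i ∧ g i) + 𝟙 (g p) ≡
              #ₙ (λ i → i ∈ᶜ 0F ∧ g i) + 𝟙 (g q) + 𝟙 (g o) + 𝟙 (g o′)
  #-B g = begin
    -- As a formal sum, B = A₁ - p + q + o + o′. The term of p stands on the left because counts are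
    -- natural numbers.
    #ₙ (λ i → B i ∧ g i) + 𝟙 (g p)
      ≡⟨ cong (_+ 𝟙 (g p)) (trans (#-classes (λ i → B i ∧ g i)) (cong₂ _+_ (cong₂ _+_ (cong (s₀ +_)
           (#-B-point g cls-o′ (λ _ → refl))) (#-B-point g cls-q (λ _ → refl)))
           (#-B-point g cls-o (λ _ → refl)))) ⟩
    s₀ + 𝟙 (g o′) + 𝟙 (g q) + 𝟙 (g o) + 𝟙 (g p)
      ≡⟨ rearrange s₀ (𝟙 (g o′)) (𝟙 (g q)) (𝟙 (g o)) (𝟙 (g p)) ⟩
    s₀ + 𝟙 (g p) + 𝟙 (g q) + 𝟙 (g o) + 𝟙 (g o′)
      ≡⟨ cong (λ m → m + 𝟙 (g q) + 𝟙 (g o) + 𝟙 (g o′)) (#-B-class₀ g) ⟩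
    #ₙ (λ i → i ∈ᶜ 0F ∧ g i) + 𝟙 (g q) + 𝟙 (g o) + 𝟙 (g o′) ∎
    where
    open ≡-Reasoning
    s₀ : ℕ
    s₀ = #ₙ (λ i → (B i ∧ g i) ∧ i ∈ᶜ 0F)
    rearrange : ∀ a b c d e → a + b + c + d + e ≡ a + e + c + d + b
    rearrange = solve-∀

  -- Numbers of factorisations and the strictly Deza property

  module Counts (κ : ℕ) (class-size : ∀ j → # (_∈ᶜ j) (allFin n) ≡ 2 + κ) where

    -- κ stands for k - 2, so that the sizes can be written without subtraction: k = 2 + κ for a
    -- class, k - 1 = 1 + κ for the part of `B` in A₁, and 2k - 2 = 2 + κ + κ.
    bᶜ : Fin 4 → ℕ
    bᶜ 0F = suc κ
    bᶜ 1F = 1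
    bᶜ 2F = 1
    bᶜ 3F = 1

    #-B∩class : ∀ j → #ₙ (λ i → B i ∧ i ∈ᶜ j) ≡ bᶜ j
    #-B∩class j = trans (#-cong (λ i → cong (_∧ i ∈ᶜ j) (sym (∧-identityʳ (B i)))) (allFin n)) (go j)
      where
      go : ∀ j → #ₙ (λ i → (B i ∧ true) ∧ i ∈ᶜ j) ≡ bᶜ j
      go 0F = suc-injective (trans (+-comm 1 _) (trans (#-B-class₀ (λ _ → true))
                (trans (#-cong (λ i → ∧-identityʳ (i ∈ᶜ 0F)) (allFin n)) (class-size 0F))))
      go 1F = #-B-point (λ _ → true) cls-o′ (λ _ → refl)
      go 2F = #-B-point (λ _ → true) cls-q (λ _ → refl)
      go 3F = #-B-point (λ _ → true) cls-o (λ _ → refl)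

    #-∈ᶜ-translate : ∀ c m → #ₙ (λ i → i ∈ᶜ c ∧ B (i ⊕ m)) ≡ bᶜ (c +₄ cls m)
    #-∈ᶜ-translate c m = begin
      #ₙ (λ i → i ∈ᶜ c ∧ B (i ⊕ m))                        ≡⟨ #-cong shifted (allFin n) ⟩
      #ₙ (λ i → B (i ⊕ m) ∧ (i ⊕ m) ∈ᶜ (c +₄ cls m))       ≡⟨ #-translate m (λ i → B i ∧ i ∈ᶜ (c +₄ cls m)) ⟩
      #ₙ (λ i → B i ∧ i ∈ᶜ (c +₄ cls m))                   ≡⟨ #-B∩class (c +₄ cls m) ⟩
      bᶜ (c +₄ cls m)                                      ∎
      where
      open ≡-Reasoning
      translate₄ : ∀ a b c → does (a Fin.≟ c) ≡ does ((a +₄ b) Fin.≟ (c +₄ b))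
      translate₄ = toWitness {a? = all? λ a → all? λ b → all? λ c → _ ≟ᵇ _} _
      -- Adding m carries class `c` onto class `c +₄ cls m`, so membership of i can be tested on
      -- `i ⊕ m`.
      shifted : ∀ i → i ∈ᶜ c ∧ B (i ⊕ m) ≡ B (i ⊕ m) ∧ (i ⊕ m) ∈ᶜ (c +₄ cls m)
      shifted i = trans (∧-comm (i ∈ᶜ c) _) (cong (B (i ⊕ m) ∧_)
        (trans (translate₄ (cls i) (cls m) c) (cong (λ a → does (a Fin.≟ (c +₄ cls m))) (sym (cls-addₓ i m)))))

    -- A₁, the bulk of `B`, meets B - m in as many points as `B` has in the class of m. The other
    -- terms correct for the four exceptional points.
    B-autocorrelation : ∀ m → #ₙ (λ i → B i ∧ B (i ⊕ m)) + 𝟙 (B (p ⊕ m)) ≡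
      bᶜ (cls m) + 𝟙 (B (q ⊕ m)) + 𝟙 (B (o ⊕ m)) + 𝟙 (B (o′ ⊕ m))
    B-autocorrelation m = trans (#-B (λ i → B (i ⊕ m)))
      (cong (λ s → s + 𝟙 (B (q ⊕ m)) + 𝟙 (B (o ⊕ m)) + 𝟙 (B (o′ ⊕ m)))
        (trans (#-∈ᶜ-translate 0F m) (cong bᶜ (DihedralGroup.addₓ-identityˡ 4 (cls m)))))

    private
      B-⊕ : ∀ {a m i j} → cls a ≡ i → cls m ≡ j → B (a ⊕ m) ≡ Bᶜ (i +₄ j) (a ⊕ m)
      B-⊕ cls-a cls-m = B-at (cls-⊕ cls-a cls-m)

      autocorrelation : ∀ {m j b₁ b₂ b₃ b₄} → cls m ≡ j → B (p ⊕ m) ≡ b₁ →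
        B (q ⊕ m) ≡ b₂ → B (o ⊕ m) ≡ b₃ → B (o′ ⊕ m) ≡ b₄ →
        #ₙ (λ i → B i ∧ B (i ⊕ m)) + 𝟙 b₁ ≡ bᶜ j + 𝟙 b₂ + 𝟙 b₃ + 𝟙 b₄
      autocorrelation {m} refl refl refl refl refl = B-autocorrelation m

    -- A nonzero shift inside A₁ keeps every class and fixes no point. So p goes to a point of `B`,
    -- while q, o and o′ leave `B`, each being its only point in its class.
    autocorrelation₀ : ∀ {m} → cls m ≡ 0F → m ≢ xexp 0 → #ₙ (λ i → B i ∧ B (i ⊕ m)) ≡ κ
    autocorrelation₀ {m} cls-m m≢0 = +-cancelʳ-≡ 1 _ _ (trans
      (autocorrelation cls-m
        (trans (B-⊕ cls-p cls-m) (cong not (moves p)))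
        (trans (B-⊕ cls-q cls-m) (moves q))
        (trans (B-⊕ cls-o cls-m) (moves o))
        (trans (B-⊕ cls-o′ cls-m) (moves o′)))
      (identity κ))
      where
      moves : ∀ i → (i ⊕ m == i) ≡ false
      moves i = dec-false (_ Fin.≟ _) (λ eq → m≢0 (addₓ-cancelˡ i _ _ (trans eq (sym (addₓ-identityʳ i)))))
      identity : ∀ κ → suc κ + 0 + 0 + 0 ≡ κ + 1
      identity = solve-∀

    -- One pattern serves the three classes other than A₁: the bulk gives 1, one of the three added
    -- points answers exactly as p does and cancels it, and the other two give complementary
    -- answers, which makes 1 more.
    autocorrelation₁ : ∀ {m} → cls m ≡ 1F → #ₙ (λ i → B i ∧ B (i ⊕ m)) ≡ 2
    autocorrelation₁ {m} cls-m = +-cancelʳ-≡ (𝟙 (p ⊕ m == o′)) _ _ (trans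
      (autocorrelation cls-m
        (B-⊕ cls-p cls-m)
        (trans (B-⊕ cls-q cls-m) (sym (==-flip p o m)))
        (B-⊕ cls-o cls-m)
        (trans (B-⊕ cls-o′ cls-m) (==-shift o p m)))
      (identity (p ⊕ m == o′) (o ⊕ m == p)))
      where
      identity : ∀ a b → 1 + 𝟙 a + 𝟙 (not b) + 𝟙 b ≡ 2 + 𝟙 a
      identity false false = refl
      identity false true  = refl
      identity true  false = refl
      identity true  true  = refl

    autocorrelation₂ : ∀ {m} → cls m ≡ 2F → #ₙ (λ i → B i ∧ B (i ⊕ m)) ≡ 2
    autocorrelation₂ {m} cls-m = +-cancelʳ-≡ (𝟙 (m == ℓ)) _ _ (trans
      (autocorrelation cls-m
        (trans (B-⊕ cls-p cls-m) (==-cancelˡ p ℓ m))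
        (trans (B-⊕ cls-q cls-m) (cong not (trans (sym (==-flip p p m)) (==-cancelˡ p ℓ m))))
        (trans (B-⊕ cls-o cls-m) (==-cancelˡ o ℓ m))
        (trans (B-⊕ cls-o′ cls-m) (trans (sym (==-flip o o m)) (==-cancelˡ o ℓ m))))
      (identity (m == ℓ)))
      where
      identity : ∀ a → 1 + 𝟙 (not a) + 𝟙 a + 𝟙 a ≡ 2 + 𝟙 a
      identity false = refl
      identity true  = refl

    autocorrelation₃ : ∀ {m} → cls m ≡ 3F → #ₙ (λ i → B i ∧ B (i ⊕ m)) ≡ 2
    autocorrelation₃ {m} cls-m = +-cancelʳ-≡ (𝟙 (p ⊕ m == o)) _ _ (trans
      (autocorrelation cls-m
        (B-⊕ cls-p cls-m)
        (trans (B-⊕ cls-q cls-m) (==-shift p o m))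
        (trans (B-⊕ cls-o cls-m) (==-flip o p m))
        (B-⊕ cls-o′ cls-m))
      (identity (p ⊕ m == o) (o′ ⊕ m == p)))
      where
      identity : ∀ a b → 1 + 𝟙 a + 𝟙 b + 𝟙 (not b) ≡ 2 + 𝟙 a
      identity false false = refl
      identity false true  = refl
      identity true  false = refl
      identity true  true  = refl

    #-differences : ∀ m → #ₙ (λ i → i ∈ᶜ 2F ∧ (⊖ i ⊕ m) ∈ᶜ 2F) ≡ #ₙ (λ i → i ∈ᶜ 2F ∧ m ∈ᶜ 0F)
    #-differences m = #-cong (λ i → trans
      (cong (λ a → i ∈ᶜ 2F ∧ does (a Fin.≟ 2F)) (trans (cls-addₓ (⊖ i) m) (cong (_+₄ cls m) (cls-neg i))))
      (differences₄ (cls i) (cls m))) (allFin n)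
      where
      -- Two rotations in `S` have exponents of class 2, so their product lies in A₁: for i of class
      -- 2 the test on m - i depends on m alone.
      differences₄ : ∀ a b → does (a Fin.≟ 2F) ∧ does (((-₄ a) +₄ b) Fin.≟ 2F) ≡ does (a Fin.≟ 2F) ∧ does (b Fin.≟ 0F)
      differences₄ = toWitness {a? = all? λ a → all? λ b → _ ≟ᵇ _} _

    -- A rotation is a product of two rotations or of two reflections. For an exponent in A₁, each
    -- of the 2 + κ elements of x²A₁ starts a factorisation of the first kind. The second kind is
    -- counted by an autocorrelation of `B`, as reflections are involutions.
    factorisations-rotation₀ : ∀ {m} → cls m ≡ 0F → m ≢ xexp 0 → factorisations (false , m) ≡ 2 + κ + κ
    factorisations-rotation₀ {m} cls-m m≢0 = trans (count-rotations+reflections _) (cong₂ _+_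
      (trans (#-differences m) (trans (#-cong (λ i →
        trans (cong (i ∈ᶜ 2F ∧_) (dec-true (cls m Fin.≟ 0F) cls-m)) (∧-identityʳ (i ∈ᶜ 2F)))
          (allFin n)) (class-size 2F)))
      (autocorrelation₀ cls-m m≢0))

    factorisations-rotation : ∀ {m} → cls m ≢ 0F → factorisations (false , m) ≡ 2
    factorisations-rotation {m} cls-m = trans (count-rotations+reflections _) (cong₂ _+_
      (trans (#-differences m) (#-none (λ i →
        trans (cong (i ∈ᶜ 2F ∧_) (dec-false (cls m Fin.≟ 0F) cls-m)) (∧-zeroʳ (i ∈ᶜ 2F))) (allFin n)))
      (by-class (cls m) refl cls-m))
      where
      by-class : ∀ j → cls m ≡ j → j ≢ 0F → #ₙ (λ i → B i ∧ B (i ⊕ m)) ≡ 2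
      by-class 0F cls-m j≢0 = contradiction refl j≢0
      by-class 1F cls-m _ = autocorrelation₁ cls-m
      by-class 2F cls-m _ = autocorrelation₂ cls-m
      by-class 3F cls-m _ = autocorrelation₃ cls-m

    -- One factor is a rotation and the other a reflection. In either order the exponent of the
    -- reflection is confined to the class of m + 2, since class 2 is its own negative; hence the
    -- two equal summands.
    factorisations-reflection : ∀ m → factorisations (true , m) ≡ bᶜ (2F +₄ cls m) + bᶜ (2F +₄ cls m)
    factorisations-reflection m = trans (count-rotations+reflections _) (cong₂ _+_
      (trans (#-cong (λ i → cong (λ a → i ∈ᶜ 2F ∧ B (a ⊕ m)) (negₓ-involutive i)) (allFin n)) (#-∈ᶜ-translate 2F m))
      (trans (#-cong (λ i → cong (B i ∧_) (trans
          (cong (λ a → does (a Fin.≟ 2F)) (trans (cls-addₓ (⊖ i) m) (cong (_+₄ cls m) (cls-neg i))))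
          (differences₄ (cls i) (cls m)))) (allFin n))
        (#-B∩class (2F +₄ cls m))))
      where
      differences₄ : ∀ a b → does (((-₄ a) +₄ b) Fin.≟ 2F) ≡ does (a Fin.≟ (2F +₄ b))
      differences₄ = toWitness {a? = all? λ a → all? λ b → _ ≟ᵇ _} _

    factorisations-values : ∀ z → z ≢ e → factorisations z ≡ 2 ⊎ factorisations z ≡ 2 + κ + κ
    factorisations-values (false , m) z≢e with cls m Fin.≟ 0F
    ... | yes cls-m = inj₂ (factorisations-rotation₀ cls-m (λ { refl → z≢e refl }))
    ... | no  cls-m = inj₁ (factorisations-rotation cls-m)
    factorisations-values (true , m) _ =
      subst (λ s → s ≡ 2 ⊎ s ≡ 2 + κ + κ) (sym (factorisations-reflection m)) (double (cls m))
      where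
      double : ∀ j → bᶜ (2F +₄ j) + bᶜ (2F +₄ j) ≡ 2 ⊎ bᶜ (2F +₄ j) + bᶜ (2F +₄ j) ≡ 2 + κ + κ
      double 0F = inj₁ refl
      double 1F = inj₁ refl
      double 2F = inj₂ (cong suc (+-suc κ κ))
      double 3F = inj₁ refl

    factorisations-q : factorisations (true , q) ≡ 2 + κ + κ
    factorisations-q = trans (factorisations-reflection q)
      (trans (cong (λ j → bᶜ (2F +₄ j) + bᶜ (2F +₄ j)) cls-q) (cong suc (+-suc κ κ)))

    2≢2+κ+κ : κ ≢ 0 → 2 ≢ 2 + κ + κ
    2≢2+κ+κ κ≢0 eq = κ≢0 (m+n≡0⇒m≡0 κ (sym (suc-injective (suc-injective eq))))

    S-q : S (true , q) ≡ true
    S-q = trans (B-at cls-q) (dec-true (q Fin.≟ q) refl)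

    S-ℓ : S (false , ℓ) ≡ true
    S-ℓ = dec-true (cls ℓ Fin.≟ 2F) cls-ℓ

    open FinGraph elements (CayAdj S)

    isStrictlyDeza : κ ≢ 0 → IsStrictlyDeza
    isStrictlyDeza κ≢0 = isDeza , ¬isSRG , diameter2
      where
      quotient≢e : ∀ {u v} → u ≢ v → v · inv u ≢ e
      quotient≢e {u} {v} u≢v eq = u≢v (sym (·-cancelʳ (inv u) v u (trans eq (sym (·-inverseʳ u)))))

      common-values : ∀ u v → u ≢ v → common u v ≡ 2 ⊎ common u v ≡ 2 + κ + κ
      common-values u v u≢v = subst (λ s → s ≡ 2 ⊎ s ≡ 2 + κ + κ) (sym (common-factorisations u v))
        (factorisations-values (v · inv u) (quotient≢e u≢v))

      isDeza : IsDeza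
      isDeza = Dihedral.count n S , 2 , 2 + κ + κ , Cay-regular , common-values

      ·-inv-e : ∀ g → g · inv e ≡ g
      ·-inv-e g = trans (cong (g ·_) (trans (sym (·-identityʳ (inv e))) (·-inverseˡ e))) (·-identityʳ g)

      e≢ : ∀ {g} → S g ≡ true → e ≢ g
      e≢ Sg refl with () ← trans (sym Sg)
        (dec-false (cls (xexp 0) Fin.≟ 2F) (λ eq → contradiction (trans (sym cls-0) eq) (λ ())))

      common-e : ∀ g → common e g ≡ factorisations g
      common-e g = trans (common-factorisations e g) (cong factorisations (·-inv-e g))

      -- (false , ℓ) and (true , q) are both neighbours of e, with different numbers of common neighbours.
      ¬isSRG : ¬ IsSRG
      ¬isSRG (_ , l , _ , _ , adjacent , _) = 2≢2+κ+κ κ≢0 (begin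
        2                              ≡⟨ factorisations-rotation (λ eq → contradiction (trans (sym cls-ℓ) eq) (λ ())) ⟨
        factorisations (false , ℓ)     ≡⟨ neighbour S-ℓ ⟩
        l                              ≡⟨ neighbour S-q ⟨
        factorisations (true , q)      ≡⟨ factorisations-q ⟩
        2 + κ + κ                      ∎)
        where
        open ≡-Reasoning
        neighbour : ∀ {g} → S g ≡ true → factorisations g ≡ l
        neighbour {g} Sg = trans (sym (common-e g))
          (adjacent e g (e≢ Sg) (trans (cong S (·-inv-e g)) Sg))

      diameter2 : Diameter2
      -- Both possible numbers of common neighbours are positive, so a path of length 2 always
      -- exists. The vertex x⁻¹ is not adjacent to `e`, because the rotations in `S` have class 2.
      diameter2 = (λ u v u≢v → inj₂ (#-∃⁻ _ elements (positive u v u≢v))) ,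
                  e , (false , o) , e≢o , trans (cong S (·-inv-e (false , o))) S-o
        where
        positive : ∀ u v → u ≢ v → common u v ≢ 0
        positive u v u≢v eq with common-values u v u≢v
        ... | inj₁ eq₂ = contradiction (trans (sym eq) eq₂) λ ()
        ... | inj₂ eq₂ = contradiction (trans (sym eq) eq₂) λ ()
        S-o : S (false , o) ≡ false
        S-o = dec-false (cls o Fin.≟ 2F) (λ eq → contradiction (trans (sym cls-o) eq) λ ())
        e≢o : e ≢ (false , o)
        e≢o eq = contradiction (trans (sym cls-0) (trans (cong cls (,-injectiveʳ eq)) cls-o)) λ ()

  -- The S-ring of singletons and pairs of twins

  odd₄ : Fin 4 → Bool
  odd₄ 0F = false
  odd₄ 1F = true
  odd₄ 2F = false
  odd₄ 3F = true

  odd : Elt → Bool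
  odd (_ , i) = odd₄ (cls i)

  L : Elt
  L = false , ℓ

  -- This is multiplication by the involution `L` from either side: `L` is central because -ℓ = ℓ.
  twin : Elt → Elt
  twin (b , i) = b , i ⊕ ℓ

  twin-·L : ∀ g → twin g ≡ g · L
  twin-·L (b , i) = cong (_, i ⊕ ℓ) (sym (xor-identityʳ b))

  twin-L· : ∀ g → twin g ≡ L · g
  twin-L· (false , i) = cong (false ,_) (addₓ-comm i ℓ)
  twin-L· (true  , i) = cong (true ,_) (trans (addₓ-comm i ℓ) (cong (_⊕ i) (addₓ-inverseˡ-unique ℓ ℓ ℓ-order)))

  twin-involutive : ∀ g → twin (twin g) ≡ g
  twin-involutive (b , i) = cong (b ,_) (⊕ℓ⊕ℓ i)

  odd-twin : ∀ g → odd (twin g) ≡ odd g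
  odd-twin (_ , i) = trans (cong odd₄ (cls-⊕ refl cls-ℓ)) (shift (cls i))
    where
    shift : ∀ a → odd₄ (a +₄ 2F) ≡ odd₄ a
    shift = toWitness {a? = all? λ a → _ ≟ᵇ _} _

  -- Negation keeps the parity of an exponent, so this parity is a homomorphism from the dihedral
  -- group to ℤ/2.
  odd-quotient : ∀ g h → odd (inv g · h) ≡ odd g xor odd h
  odd-quotient (false , i) (false , j) = trans (cong odd₄ (cls-⊖⊕ refl refl)) (diff (cls i) (cls j))
    where
    diff : ∀ a b → odd₄ ((-₄ a) +₄ b) ≡ odd₄ a xor odd₄ b
    diff = toWitness {a? = all? λ a → all? λ b → _ ≟ᵇ _} _
  odd-quotient (true , i) (true , j) = odd-quotient (false , i) (false , j)
  odd-quotient (true , i) (false , j) = trans (cong odd₄ (cls-⊕ refl refl)) (plus (cls i) (cls j))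
    where
    plus : ∀ a b → odd₄ (a +₄ b) ≡ odd₄ a xor odd₄ b
    plus = toWitness {a? = all? λ a → all? λ b → _ ≟ᵇ _} _
  odd-quotient (false , i) (true , j) = trans (cong (λ a → odd₄ (cls (a ⊕ j))) (negₓ-involutive i))
    (odd-quotient (true , i) (false , j))

  module Colouring {R : ℕ} (colour : Elt → Fin R)
    (colour-surjective : ∀ i → ∃ λ g → colour g ≡ i)
    (colour-separates : ∀ g h → colour g ≡ colour h → h ≡ g ⊎ (odd g ≡ true × h ≡ twin g))
    (colour-twin : ∀ g → odd g ≡ true → colour (twin g) ≡ colour g)
    where

    private
      odd-e : odd e ≡ false
      odd-e = cong odd₄ cls-0

      respects-twin : {A : Set} (f : Elt → A) → (∀ g → odd g ≡ true → f g ≡ f (twin g)) →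
                      ∀ g h → colour g ≡ colour h → f g ≡ f h
      respects-twin f f-twin g h eq with colour-separates g h eq
      ... | inj₁ refl           = refl
      ... | inj₂ (odd-g , refl) = f-twin g odd-g

      φ : Elt → Elt
      φ a = if odd a then twin a else a

      φ-involutive : ∀ a → φ (φ a) ≡ a
      φ-involutive a with odd a in eq
      ... | false rewrite eq = refl
      ... | true rewrite trans (odd-twin a) eq = twin-involutive a

      φ-colour : ∀ a → colour (φ a) ≡ colour a
      φ-colour a with odd a in eq
      ... | false = refl
      ... | true  = colour-twin a eq

      -- If `a` is even, it stays, and the cofactor, which is odd, is replaced by its twin of the
      -- same colour. If `a` is odd, it absorbs the factor `L` and the cofactor is unchanged.
      φ-quotient : ∀ z → odd z ≡ true → ∀ a → colour (inv (φ a) · twin z) ≡ colour (inv a · z)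
      φ-quotient z odd-z a with odd a in eq
      ... | false = trans (cong colour (begin
          inv a · twin z       ≡⟨ cong (inv a ·_) (twin-·L z) ⟩
          inv a · (z · L)      ≡⟨ ·-assoc (inv a) z L ⟨
          (inv a · z) · L      ≡⟨ twin-·L (inv a · z) ⟨
          twin (inv a · z)     ∎)) (colour-twin (inv a · z) (trans (odd-quotient a z) (cong₂ _xor_ eq odd-z)))
        where open ≡-Reasoning
      ... | true = cong colour (begin
          inv (twin a) · twin z                       ≡⟨ cong (inv (twin a) ·_) (begin
            twin z                       ≡⟨ twin-L· z ⟩
            L · z                        ≡⟨ cong (L ·_) (inv-cancelʳ a z) ⟨
            L · (a · (inv a · z))        ≡⟨ ·-assoc L a (inv a · z) ⟨
            (L · a) · (inv a · z)        ≡⟨ cong (_· (inv a · z)) (twin-L· a) ⟨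
            twin a · (inv a · z)         ∎) ⟩
          inv (twin a) · (twin a · (inv a · z))       ≡⟨ inv-cancelˡ (twin a) (inv a · z) ⟩
          inv a · z                                   ∎)
        where open ≡-Reasoning

      inv-twin : ∀ g → odd g ≡ true → colour (inv g) ≡ colour (inv (twin g))
      inv-twin (true  , i) odd-g = sym (colour-twin (true , i) odd-g)
      inv-twin (false , i) odd-g = trans (sym (colour-twin (false , ⊖ i) odd-inv)) (cong (λ a → colour (false , a))
          (trans (cong (⊖ i ⊕_) (addₓ-inverseˡ-unique ℓ ℓ ℓ-order)) (negₓ-addₓ i ℓ)))
        where
        odd-inv : odd (false , ⊖ i) ≡ true
        odd-inv = trans (cong odd₄ (cls-neg i)) (trans (negate (cls i)) odd-g)
          where
          negate : ∀ a → odd₄ (-₄ a) ≡ odd₄ a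
          negate = toWitness {a? = all? λ a → _ ≟ᵇ _} _

    colour-isSRing : IsSRing colour
    colour-isSRing = colour-surjective , singleton-e , respects-twin (colour ∘ inv) inv-twin , coeff-constant
      where
      singleton-e : ∀ g → colour g ≡ colour e → g ≡ e
      singleton-e g eq with colour-separates e g (sym eq)
      ... | inj₁ g≡e         = g≡e
      ... | inj₂ (odd-e′ , _) = contradiction (trans (sym odd-e) odd-e′) λ ()

      coeff-constant : ∀ i j z z′ → colour z ≡ colour z′ → coeff colour i j z ≡ coeff colour i j z′
      -- For odd `z` the substitution `φ` matches the factorisations of `z` with those of `twin z`,
      -- colour by colour.
      coeff-constant i j = respects-twin (coeff colour i j) λ z odd-z → trans
        (#-cong (λ a → sym (cong₂ (λ c d → does (c Fin.≟ i) ∧ does (d Fin.≟ j))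
                                  (φ-colour a) (φ-quotient z odd-z a))) elements)
        (#-bijection elements-enumerates φ φ φ-involutive φ-involutive
          (λ a → does (colour a Fin.≟ i) ∧ does (colour (inv a · twin z) Fin.≟ j)))

    S-isUnionOfBasic : IsUnionOfBasic S colour
    S-isUnionOfBasic = respects-twin S S-twin
      where
      -- No odd rotation lies in `S`. The odd reflections in `S` have the exponents o and o′ = o +
      -- ℓ, which `twin` exchanges.
      S-twin : ∀ g → odd g ≡ true → S g ≡ S (twin g)
      S-twin (false , i) odd-g = trans (even-only i odd-g) (sym (even-only (i ⊕ ℓ) (trans (odd-twin (false , i)) odd-g)))
        where
        even-only : ∀ i → odd (false , i) ≡ true → i ∈ᶜ 2F ≡ false
        even-only i odd-i with cls i
        ... | 1F = refl
        ... | 3F = refl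
      S-twin (true , i) odd-g = by-class (cls i) refl odd-g
        where
        ⊕0 : ∀ j → (i ⊕ xexp 0 == j) ≡ (i == j)
        ⊕0 j = cong (_== j) (addₓ-identityʳ i)
        by-class : ∀ j → cls i ≡ j → odd₄ j ≡ true → B i ≡ B (i ⊕ ℓ)
        by-class 1F cls-i _ = begin
          B i                          ≡⟨ B-at cls-i ⟩
          (i == o ⊕ ℓ)                 ≡⟨ ⊕0 _ ⟨
          (i ⊕ xexp 0 == o ⊕ ℓ)        ≡⟨ ==-flip i o (xexp 0) ⟩
          ((i ⊕ ℓ) ⊕ xexp 0 == o)      ≡⟨ cong (_== o) (addₓ-identityʳ (i ⊕ ℓ)) ⟩
          (i ⊕ ℓ == o)                 ≡⟨ B-at (cls-⊕ cls-i cls-ℓ) ⟨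
          B (i ⊕ ℓ)                    ∎ where open ≡-Reasoning
        by-class 3F cls-i _ = begin
          B i                          ≡⟨ B-at cls-i ⟩
          (i == o)                     ≡⟨ ⊕0 _ ⟨
          (i ⊕ xexp 0 == o)            ≡⟨ ==-shift i o (xexp 0) ⟨
          ((i ⊕ ℓ) ⊕ xexp 0 == o ⊕ ℓ)  ≡⟨ cong (_== o ⊕ ℓ) (addₓ-identityʳ (i ⊕ ℓ)) ⟩
          (i ⊕ ℓ == o ⊕ ℓ)             ≡⟨ B-at (cls-⊕ cls-i cls-ℓ) ⟨
          B (i ⊕ ℓ)                    ∎ where open ≡-Reasoning

  -- Separation of elements in an arbitrary S-ring compatible with `S`

  module Minimality (κ : ℕ) (class-size : ∀ j → # (_∈ᶜ j) (allFin n) ≡ 2 + κ) (κ≢0 : κ ≢ 0)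
    (δ : Fin n) (q⊕δ : q ⊕ δ ≡ o) (o⊕δ : o ⊕ δ ≡ xexp 0)
    (p≢0 : p ≢ xexp 0) (δ⊕δ≢ℓ : δ ⊕ δ ≢ ℓ)
    (even-induction : (P : Fin n → Set) → P (xexp 0) → (∀ i → P i → P (i ⊕ (⊖ q))) →
                      ∀ i → odd₄ (cls i) ≡ false → P i)
    {r : ℕ} (c : Elt → Fin r) (isSRing : IsSRing c) (union : IsUnionOfBasic S c)
    where
    open Counts κ class-size
    open SRingProperties n c isSRing

    private
      cls-δ : cls δ ≡ 1F
      cls-δ = DihedralGroup.addₓ-cancelˡ 4 2F (cls δ) 1F
        (trans (sym (cls-⊕ cls-q refl)) (trans (cong cls q⊕δ) cls-o))

      S-transfer : ∀ {g h b} → h ~ g → S g ≡ b → S h ≡ b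
      S-transfer h~g Sg = trans (union _ _ h~g) Sg

      ∈ᶜ⁻ : ∀ {i j} → i ∈ᶜ j ≡ true → cls i ≡ j
      ∈ᶜ⁻ {i} {j} = does-true⁻ (cls i Fin.≟ j)

      ==⁻ : ∀ {i j} → (i == j) ≡ true → i ≡ j
      ==⁻ {i} {j} = does-true⁻ (i Fin.≟ j)

      cls≢ : ∀ {i j k} → cls i ≡ j → cls i ≡ k → j ≢ k → ∀ {A : Set} → A
      cls≢ refl eq j≢k = contradiction eq j≢k

      s : Elt
      s = true , q

      true≢false : ∀ {b} → b ≡ true → b ≡ false → ∀ {A : Set} → A
      true≢false refl ()

    -- Membership in `S` and the number of factorisations are constant on the basic set of `s`. A
    -- rotation in `S` has class 2 and only 2 factorisations; a reflection with 2 + κ + κ of them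
    -- has an exponent of class 2, where `B` contains only q.
    singleton-s : Singleton s
    singleton-s h h~s = unique h (S-transfer h~s S-q)
      (trans (count-factorisations-~ union h~s) factorisations-q)
      where
      unique : ∀ h → S h ≡ true → factorisations h ≡ 2 + κ + κ → h ≡ s
      unique (false , i) Sh fh = contradiction
        (trans (sym (factorisations-rotation (λ cls-i → cls≢ (∈ᶜ⁻ Sh) cls-i λ ()))) fh) (2≢2+κ+κ κ≢0)
      unique (true , i) Sh fh = by-class (cls i) refl (trans (sym (factorisations-reflection i)) fh)
        where
        by-class : ∀ j → cls i ≡ j → bᶜ (2F +₄ cls i) + bᶜ (2F +₄ cls i) ≡ 2 + κ + κ → (true , i) ≡ s
        by-class 0F cls-i fh rewrite cls-i = contradiction fh (2≢2+κ+κ κ≢0)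
        by-class 1F cls-i fh rewrite cls-i = contradiction fh (2≢2+κ+κ κ≢0)
        by-class 2F cls-i fh = cong (true ,_) (==⁻ (trans (sym (B-at cls-i)) Sh))
        by-class 3F cls-i fh rewrite cls-i = contradiction fh (2≢2+κ+κ κ≢0)

    -- δ stands for the exponent 1. As `{s}` is basic and s = s⁻¹, the conditions sh ∈ S and hs ∉ S
    -- pass from x to its whole basic set. No reflection h satisfies both: the two products are
    -- mutually inverse rotations, and class 2 is closed under negation. For h = x^i they say q + i
    -- ∈ B and q - i ∉ B; in classes 0 and 2 one of them forces i = 0 or i = ℓ, where q + i = q - i.
    ~δ : ∀ h → h ~ (false , δ) → h ≡ (false , δ) ⊎ h ≡ (false , δ ⊕ ℓ)
    ~δ h h~δ = unique h (S-transfer (~-cancelˡ singleton-s h~δ) S-sδ) (S-transfer (~-cancelʳ singleton-s h~δ) S-δs)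
      where
      S-sδ : S (s · (false , δ)) ≡ true
      S-sδ = trans (cong B q⊕δ) (trans (B-at cls-o) (dec-true (o Fin.≟ o) refl))
      -- If -3 and 2k - 1 agreed modulo 4k, then so would 2 and 2k, because 2k is its own negative.
      ⊖δ⊕q≢o′ : ⊖ δ ⊕ q ≢ o′
      ⊖δ⊕q≢o′ eq = δ⊕δ≢ℓ (begin
        δ ⊕ δ               ≡⟨ ⊕ℓ⊕ℓ (δ ⊕ δ) ⟨
        δ ⊕ δ ⊕ ℓ ⊕ ℓ       ≡⟨ cong (_⊕ ℓ) (addₓ-cancelˡ q _ _ (begin
          q ⊕ (δ ⊕ δ ⊕ ℓ)     ≡⟨ cong (q ⊕_) (trans (addₓ-assoc δ δ ℓ)
                                   (trans (addₓ-comm δ (δ ⊕ ℓ)) (addₓ-assoc δ ℓ δ))) ⟩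
          q ⊕ (δ ⊕ (ℓ ⊕ δ))   ≡⟨ addₓ-assoc q δ (ℓ ⊕ δ) ⟨
          q ⊕ δ ⊕ (ℓ ⊕ δ)     ≡⟨ cong (_⊕ (ℓ ⊕ δ)) q⊕δ ⟩
          o ⊕ (ℓ ⊕ δ)         ≡⟨ addₓ-assoc o ℓ δ ⟨
          o′ ⊕ δ              ≡⟨ cong (_⊕ δ) eq ⟨
          ⊖ δ ⊕ q ⊕ δ         ≡⟨ ⊕-swap (⊖ δ) q δ ⟩
          ⊖ δ ⊕ δ ⊕ q         ≡⟨ cong (_⊕ q) (addₓ-inverseˡ δ) ⟩
          xexp 0 ⊕ q          ≡⟨ addₓ-comm (xexp 0) q ⟩
          q ⊕ xexp 0          ∎)) ⟩
        xexp 0 ⊕ ℓ          ≡⟨ addₓ-identityˡ ℓ ⟩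
        ℓ                   ∎) where open ≡-Reasoning
      S-δs : S ((false , δ) · s) ≡ false
      S-δs = trans (B-at (cls-⊖⊕ cls-δ cls-q)) (dec-false (_ Fin.≟ _) ⊖δ⊕q≢o′)
      unique : ∀ h → S (s · h) ≡ true → S (h · s) ≡ false → h ≡ (false , δ) ⊎ h ≡ (false , δ ⊕ ℓ)
      unique (true , i) Ssh Shs = true≢false Ssh (trans (trans
        (cong (λ a → does (a Fin.≟ 2F)) (cls-⊖⊕ cls-q refl)) (trans (symmetric (cls i))
        (cong (λ a → does (a Fin.≟ 2F)) (sym (cls-⊖⊕ refl cls-q))))) Shs)
        where
        symmetric : ∀ a → does (((-₄ 2F) +₄ a) Fin.≟ 2F) ≡ does (((-₄ a) +₄ 2F) Fin.≟ 2F)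
        symmetric = toWitness {a? = all? λ a → _ ≟ᵇ _} _
      unique (false , i) Ssh Shs = by-class (cls i) refl
        where
        by-class : ∀ j → cls i ≡ j → (false , i) ≡ (false , δ) ⊎ (false , i) ≡ (false , δ ⊕ ℓ)
        by-class 0F cls-i = true≢false (trans (B-at (cls-⊖⊕ cls-i cls-q)) (dec-true (_ Fin.≟ _) ⊖i⊕q)) Shs
          where
          i≡0 : i ≡ xexp 0
          i≡0 = addₓ-cancelˡ q _ _ (trans (==⁻ (trans (sym (B-at (cls-⊕ cls-q cls-i))) Ssh)) (sym (addₓ-identityʳ q)))
          ⊖i⊕q : ⊖ i ⊕ q ≡ q
          ⊖i⊕q = trans (cong (_⊕ q) (trans (cong ⊖_ i≡0) negₓ-zero)) (addₓ-identityˡ q)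
        by-class 1F cls-i = inj₁ (cong (false ,_) (addₓ-cancelˡ q _ _
          (trans (==⁻ (trans (sym (B-at (cls-⊕ cls-q cls-i))) Ssh)) (sym q⊕δ))))
        by-class 2F cls-i = true≢false (dec-true (q ⊕ i Fin.≟ p) q⊕i≡p)
          (not-injective (trans (sym (B-at (cls-⊕ cls-q cls-i))) Ssh))
          where
          ⊖i⊕q≡p : ⊖ i ⊕ q ≡ p
          ⊖i⊕q≡p = ==⁻ (not-injective (trans (sym (B-at (cls-⊖⊕ cls-i cls-q))) Shs))
          i≡ℓ : i ≡ ℓ
          i≡ℓ = addₓ-cancelˡ p _ _ (begin
            p ⊕ i                ≡⟨ cong (_⊕ i) ⊖i⊕q≡p ⟨
            ⊖ i ⊕ q ⊕ i          ≡⟨ ⊕-swap (⊖ i) q i ⟩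
            ⊖ i ⊕ i ⊕ q          ≡⟨ cong (_⊕ q) (addₓ-inverseˡ i) ⟩
            xexp 0 ⊕ q           ≡⟨ addₓ-identityˡ q ⟩
            q                    ∎) where open ≡-Reasoning
          q⊕i≡p : q ⊕ i ≡ p
          q⊕i≡p = trans (cong (q ⊕_) i≡ℓ) (⊕ℓ⊕ℓ p)
        by-class 3F cls-i = inj₂ (cong (false ,_) (addₓ-cancelˡ q _ _ (begin
          q ⊕ i           ≡⟨ ==⁻ (trans (sym (B-at (cls-⊕ cls-q cls-i))) Ssh) ⟩
          o ⊕ ℓ           ≡⟨ cong (_⊕ ℓ) q⊕δ ⟨
          q ⊕ δ ⊕ ℓ       ≡⟨ addₓ-assoc q δ ℓ ⟩
          q ⊕ (δ ⊕ ℓ)     ∎)))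
          where open ≡-Reasoning

    private
      o⊕δ⊕ℓ : o ⊕ (δ ⊕ ℓ) ≡ ℓ
      o⊕δ⊕ℓ = trans (sym (addₓ-assoc o δ ℓ)) (trans (cong (_⊕ ℓ) o⊕δ) (addₓ-identityˡ ℓ))

      o′⊕δ : o′ ⊕ δ ≡ ℓ
      o′⊕δ = trans (⊕-swap o ℓ δ) (trans (cong (_⊕ ℓ) o⊕δ) (addₓ-identityˡ ℓ))

      o′⊕δ⊕ℓ : o′ ⊕ (δ ⊕ ℓ) ≡ xexp 0
      o′⊕δ⊕ℓ = trans (⊕-swap o ℓ (δ ⊕ ℓ)) (trans (cong (_⊕ ℓ) o⊕δ⊕ℓ) ℓ-order)

      B-ℓ : B ℓ ≡ false
      B-ℓ = trans (B-at cls-ℓ) (dec-false (ℓ Fin.≟ q)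
        (λ ℓ≡q → p≢0 (addₓ-cancelʳ ℓ _ _ (trans (sym ℓ≡q) (sym (addₓ-identityˡ ℓ))))))

      cls-δδℓ : ∀ {a} → a ≡ δ ⊎ a ≡ δ ⊕ ℓ → cls a ≡ 1F ⊎ cls a ≡ 3F
      cls-δδℓ (inj₁ refl) = inj₁ cls-δ
      cls-δδℓ (inj₂ refl) = inj₂ (cls-⊕ cls-δ cls-ℓ)

      y-from-o : ∀ {a} → a ≡ δ ⊎ a ≡ δ ⊕ ℓ → B (o ⊕ a) ≡ true → o ⊕ a ≡ xexp 0
      y-from-o (inj₁ refl) _ = o⊕δ
      y-from-o (inj₂ refl) Bh = true≢false Bh (trans (cong B o⊕δ⊕ℓ) B-ℓ)

      y-from-o′ : ∀ {a} → a ≡ δ ⊎ a ≡ δ ⊕ ℓ → B (o′ ⊕ a) ≡ true → o′ ⊕ a ≡ xexp 0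
      y-from-o′ (inj₁ refl) Bh = true≢false Bh (trans (cong B o′⊕δ) B-ℓ)
      y-from-o′ (inj₂ refl) _ = o′⊕δ⊕ℓ

      -- A rotation in `S` times x or x^(2k+1) is an odd rotation, hence not in `S`. Among the
      -- reflections `b`, class 0 is excluded because `s · b` would be a rotation of class 2, and
      -- class 2 because b ≠ s; the exponents o and o′ remain. Their sums with δ and δ + ℓ are 0 or
      -- ℓ, and ℓ ∉ B leaves only `y`.
      factors-of-y : ∀ b {a} → S b ≡ true → S (s · b) ≡ false → b ≢ s → a ≡ δ ⊎ a ≡ δ ⊕ ℓ →
                     S (b · (false , a)) ≡ true → b · (false , a) ≡ y
      factors-of-y (false , j) {a} Sb _ _ a∈ Sh with cls-δδℓ a∈
      ... | inj₁ cls-a = cls≢ (∈ᶜ⁻ Sh) (cls-⊕ (∈ᶜ⁻ Sb) cls-a) λ ()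
      ... | inj₂ cls-a = cls≢ (∈ᶜ⁻ Sh) (cls-⊕ (∈ᶜ⁻ Sb) cls-a) λ ()
      factors-of-y (true , j) {a} Sb Ssb b≢s a∈ Sh = cong (true ,_) (by-class (cls j) refl)
        where
        by-class : ∀ k → cls j ≡ k → j ⊕ a ≡ xexp 0
        by-class 0F cls-j = true≢false (dec-true (_ Fin.≟ 2F) (cls-⊖⊕ cls-q cls-j)) Ssb
        by-class 1F cls-j = subst (λ j → B (j ⊕ a) ≡ true → j ⊕ a ≡ xexp 0)
          (sym (==⁻ (trans (sym (B-at cls-j)) Sb))) (y-from-o′ a∈) Sh
        by-class 2F cls-j = contradiction (cong (true ,_) (==⁻ (trans (sym (B-at cls-j)) Sb))) b≢s
        by-class 3F cls-j = subst (λ j → B (j ⊕ a) ≡ true → j ⊕ a ≡ xexp 0)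
          (sym (==⁻ (trans (sym (B-at cls-j)) Sb))) (y-from-o a∈) Sh

    -- Start from y = (yx⁻¹)x. By `~-factor`, any h ~ y is a product of some b ~ yx⁻¹ and some
    -- element of the basic set of x. The second factor is known from `~δ`, and b shares with yx⁻¹
    -- the properties that `factors-of-y` asks for.
    singleton-y : Singleton y
    singleton-y h h~y = conclude (~-factor (sym h~y) (true , o))
      where
      S-h : S h ≡ true
      S-h = S-transfer h~y (trans (B-at cls-0) (cong not (dec-false (xexp 0 Fin.≟ p) (≢-sym p≢0))))
      o⁻¹y≡δ : (true , o) · y ≡ (false , δ)
      o⁻¹y≡δ = cong (false ,_)
        (trans (addₓ-identityʳ (⊖ o)) (sym (addₓ-inverseˡ-unique δ o (trans (addₓ-comm δ o) o⊕δ))))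
      module _ (b : Elt) (b~o : b ~ (true , o)) where
        S-b : S b ≡ true
        S-b = S-transfer b~o (trans (B-at cls-o) (dec-true (o Fin.≟ o) refl))
        S-sb : S (s · b) ≡ false
        S-sb = S-transfer (~-cancelˡ singleton-s b~o)
          (dec-false (cls (⊖ q ⊕ o) Fin.≟ 2F) (λ eq → cls≢ (cls-⊖⊕ cls-q cls-o) eq λ ()))
        b≢s : b ≢ s
        b≢s b≡s = cls≢ cls-q (trans (cong cls (sym (,-injectiveʳ
          (singleton-s (true , o) (trans (sym b~o) (cong c b≡s)))))) cls-o) λ ()
        finish : ∀ {a} → a ≡ δ ⊎ a ≡ δ ⊕ ℓ → inv b · h ≡ (false , a) → h ≡ y
        finish {a} a∈ b⁻¹h = trans h≡ (factors-of-y b S-b S-sb b≢s a∈ (trans (cong S (sym h≡)) S-h))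
          where
          h≡ : h ≡ b · (false , a)
          h≡ = trans (sym (inv-cancelʳ b h)) (cong (b ·_) b⁻¹h)
      conclude : (∃ λ b → b ~ (true , o) × inv b · h ~ (true , o) · y) → h ≡ y
      conclude (b , b~o , b⁻¹h~) = [ finish b b~o (inj₁ refl) , finish b b~o (inj₂ refl) ]′
        (~δ (inv b · h) (trans b⁻¹h~ (cong c o⁻¹y≡δ)))

    singleton-even : ∀ g → odd g ≡ false → Singleton g
    singleton-even (false , i) even = even-induction (λ i → Singleton (false , i)) singleton-e
      (λ i sing → singleton-· sing singleton-⊖q) i even
      where
      singleton-⊖q : Singleton (false , ⊖ q)
      -- ys = x^q, and the inverse of this element is the step of `even-induction`.
      singleton-⊖q = subst (λ a → Singleton (false , ⊖ a)) (trans (cong (_⊕ q) negₓ-zero) (addₓ-identityˡ q))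
        (singleton-inv (singleton-· singleton-y singleton-s))
    singleton-even (true , i) even = subst (λ a → Singleton (true , a)) (addₓ-identityˡ i)
      (singleton-· singleton-y (singleton-even (false , i) even))

    odd-factor : ∀ g → odd g ≡ true → ∃ λ g₀ → odd g₀ ≡ false × g₀ · (false , δ) ≡ g
    odd-factor (b , i) odd-g = (b , i ⊕ (⊖ δ)) , even₀ , cong₂ _,_ (xor-identityʳ b)
      (trans (addₓ-assoc i (⊖ δ) δ) (trans (cong (i ⊕_) (addₓ-inverseˡ δ)) (addₓ-identityʳ i)))
      where
      shift : ∀ a → odd₄ (a +₄ 3F) ≡ not (odd₄ a)
      shift = toWitness {a? = all? λ a → _ ≟ᵇ _} _
      even₀ : odd₄ (cls (i ⊕ (⊖ δ))) ≡ false
      even₀ = trans (cong odd₄ (cls-⊕ refl (trans (cls-neg δ) (cong -₄_ cls-δ))))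
                    (trans (shift (cls i)) (cong not odd-g))

    -- An odd g is g₀x with g₀ even. Since `{g₀}` is basic, g₀ can be cancelled from g and h, which
    -- reduces the claim to `~δ`.
    ~⇒twin : ∀ g h → g ~ h → h ≡ g ⊎ (odd g ≡ true × h ≡ twin g)
    ~⇒twin g h g~h = by-parity (odd g) refl
      where
      from-factor : odd g ≡ true → (∃ λ g₀ → odd g₀ ≡ false × g₀ · (false , δ) ≡ g) →
                    h ≡ g ⊎ (odd g ≡ true × h ≡ twin g)
      from-factor odd-g (g₀ , even₀ , g₀δ≡g) = Sum.map
        (λ eq → trans (h≡ eq) g₀δ≡g)
        (λ eq → odd-g , (begin
          h                                 ≡⟨ h≡ eq ⟩
          g₀ · ((false , δ) · L)            ≡⟨ ·-assoc g₀ (false , δ) L ⟨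
          (g₀ · (false , δ)) · L            ≡⟨ cong (_· L) g₀δ≡g ⟩
          g · L                             ≡⟨ twin-·L g ⟨
          twin g                            ∎))
        (~δ (inv g₀ · h) (trans (~-cancelˡ (singleton-even g₀ even₀) (sym g~h))
          (cong c (trans (cong (inv g₀ ·_) (sym g₀δ≡g)) (inv-cancelˡ g₀ (false , δ))))))
        where
        open ≡-Reasoning
        h≡ : ∀ {a} → inv g₀ · h ≡ a → h ≡ g₀ · a
        h≡ eq = trans (sym (inv-cancelʳ g₀ h)) (cong (g₀ ·_) eq)
      by-parity : ∀ b → odd g ≡ b → h ≡ g ⊎ (odd g ≡ true × h ≡ twin g)
      by-parity false even-g = inj₁ (singleton-even g even-g h (sym g~h))
      by-parity true  odd-g  = from-factor odd-g (odd-factor g odd-g)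

-- The graph Σ(k)

-- The list-based `Z` and the class-based `S` agree pointwise, so the agreement is carried through
-- each condition of the definition.
isStrictlyDeza-cong : ∀ {V : Set} (vs : List V) {adj adj′ : V → V → Bool} →
                      (∀ u v → adj u v ≡ adj′ u v) →
                      FinGraph.IsStrictlyDeza vs adj → FinGraph.IsStrictlyDeza vs adj′
isStrictlyDeza-cong vs {adj} {adj′} eq
  ((r , a , b , regular , values) , ¬srg , (joined , u , v , u≢v , ¬adj)) =
  (r , a , b , (λ v → trans (sym (degree-eq v)) (regular v)) ,
    λ u v u≢v → Sum.map (trans (sym (common-eq u v))) (trans (sym (common-eq u v))) (values u v u≢v)) ,
  (λ (r , l , m , regular′ , adjacent , nonadjacent) → ¬srg (r , l , m ,
    (λ v → trans (degree-eq v) (regular′ v)) ,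
    (λ u v u≢v uv → trans (common-eq u v) (adjacent u v u≢v (trans (sym (eq u v)) uv))) ,
    (λ u v u≢v uv → trans (common-eq u v) (nonadjacent u v u≢v (trans (sym (eq u v)) uv))))) ,
  (λ u v u≢v → Sum.map (trans (sym (eq u v)))
    (λ (w , uwv) → w , trans (sym (cong₂ _∧_ (eq u w) (eq w v))) uwv) (joined u v u≢v)) ,
  u , v , u≢v , trans (sym (eq u v)) ¬adj
  where
  module G = FinGraph vs adj
  module G′ = FinGraph vs adj′
  degree-eq : ∀ v → G.count (adj v) ≡ G′.count (adj′ v)
  degree-eq v = #-cong (eq v) vs
  common-eq : ∀ u v → G.common u v ≡ G′.common u v
  common-eq u v = #-cong (λ w → cong₂ _∧_ (eq u w) (eq w v)) vs

WLRank-cong : ∀ n .{{_ : NonZero n}} {S S′ : Dihedral.Elt n → Bool} → S ≗ S′ → ∀ {r} →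
              Dihedral.WLRank n S r → Dihedral.WLRank n S′ r
WLRank-cong n S≗S′ (c , isSRing , union , minimal) =
  c , isSRing ,
  (λ g h eq → trans (sym (S≗S′ g)) (trans (union g h eq) (S≗S′ h))) ,
  λ r′ c′ isSRing′ union′ → minimal r′ c′ isSRing′
    (λ g h eq → trans (S≗S′ g) (trans (union′ g h eq) (sym (S≗S′ h))))

-- It is applied with d = 2: halving exponents modulo 4k gives numbers modulo 2k.
%-/-comm : ∀ a {d m h} .{{_ : NonZero d}} .{{_ : NonZero m}} .{{_ : NonZero h}} →
           m ≡ h * d → (a % m) / d ≡ (a / d) % h
%-/-comm a {d} {m} {h} m≡h*d = trans (cong (_/ d) (%-congʳ {{_}} {{m*n≢0 h d}} m≡h*d))
  (m%[n*o]/o≡m/o%n a h d {{_}} {{_}} {{m*n≢0 h d}})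

module Sigma (k : ℕ) .{{_ : NonZero k}} (3≤k : 3 ≤ k) (odd-k : Odd k) where
  n : ℕ
  n = 4 * k
  open Dihedral n renaming (addₓ to infixl 6 _⊕_; negₓ to ⊖_)
  open DihedralGroup n

  opaque
    cls : Fin n → Fin 4
    cls i = toℕ i mod 4

    cls-mod : ∀ i → cls i ≡ toℕ i mod 4
    cls-mod i = refl

  cls-xexp : ∀ a → cls (xexp a) ≡ a mod 4
  cls-xexp a = toℕ-injective (begin
    toℕ (cls (xexp a))      ≡⟨ cong toℕ (cls-mod (xexp a)) ⟩
    toℕ (toℕ (xexp a) mod 4) ≡⟨ DihedralGroup.toℕ-xexp 4 (toℕ (xexp a)) ⟩
    toℕ (xexp a) % 4        ≡⟨ cong (_% 4) (toℕ-xexp a) ⟩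
    a % n % 4               ≡⟨ m∣n⇒o%n%m≡o%m 4 n a (m∣m*n k) ⟩
    a % 4                   ≡⟨ DihedralGroup.toℕ-xexp 4 a ⟨
    toℕ (a mod 4)           ∎) where open ≡-Reasoning

  cls-addₓ : ∀ i j → cls (i ⊕ j) ≡ cls i +₄ cls j
  cls-addₓ i j = trans (cls-xexp (toℕ i + toℕ j))
    (trans (sym (DihedralGroup.xexp-+ 4 (toℕ i) (toℕ j))) (sym (cong₂ _+₄_ (cls-mod i) (cls-mod j))))

  p o ℓ : Fin n
  p = xexp (2 * (k ∸ 1))
  o = ⊖ xexp 1
  ℓ = xexp (2 * k)

  private
    m : ℕ
    m = proj₁ odd-k
    k≡ : k ≡ suc (2 * m)
    k≡ = proj₂ odd-k

  mod4 : ∀ a t → (a + t * 4) mod 4 ≡ a mod 4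
  mod4 a t = DihedralGroup.xexp-cong 4 {a + t * 4} {a} ([m+kn]%n≡m%n a t 4)

  -- For k = 2m + 1 the exponent 2(k - 1) is 4m, and 2k is 4m + 2. These two residues are where the
  -- oddness of k enters.
  cls-p : cls p ≡ 0F
  cls-p = begin
    cls p                          ≡⟨ cls-xexp _ ⟩
    (2 * (k ∸ 1)) mod 4            ≡⟨ cong (λ k → (2 * (k ∸ 1)) mod 4) k≡ ⟩
    (2 * (2 * m)) mod 4            ≡⟨ cong (_mod 4) (identity m) ⟩
    (m * 4) mod 4                  ≡⟨ mod4 0 m ⟩
    0F                             ∎
    where
    open ≡-Reasoning
    identity : ∀ m → 2 * (2 * m) ≡ m * 4
    identity = solve-∀

  cls-ℓ : cls ℓ ≡ 2F
  cls-ℓ = begin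
    cls ℓ                          ≡⟨ cls-xexp _ ⟩
    (2 * k) mod 4                  ≡⟨ cong (λ k → (2 * k) mod 4) k≡ ⟩
    (2 * suc (2 * m)) mod 4        ≡⟨ cong (_mod 4) (identity m) ⟩
    (2 + m * 4) mod 4              ≡⟨ mod4 2 m ⟩
    2F                             ∎
    where
    open ≡-Reasoning
    identity : ∀ m → 2 * suc (2 * m) ≡ 2 + m * 4
    identity = solve-∀

  cls-o : cls o ≡ 3F
  cls-o = DihedralGroup.addₓ-cancelʳ 4 1F (cls o) 3F (begin
    cls o +₄ 1F                  ≡⟨ cong (cls o +₄_) (cls-xexp 1) ⟨
    cls o +₄ cls (xexp 1)        ≡⟨ cls-addₓ o (xexp 1) ⟨
    cls (o ⊕ xexp 1)             ≡⟨ cong cls (addₓ-inverseˡ (xexp 1)) ⟩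
    cls (xexp 0)                 ≡⟨ cls-xexp 0 ⟩
    0F                           ∎) where open ≡-Reasoning

  ℓ-order : ℓ ⊕ ℓ ≡ xexp 0
  ℓ-order = trans (xexp-+ (2 * k) (2 * k)) (trans (cong xexp (identity k)) xexp-n)
    where
    identity : ∀ k → 2 * k + 2 * k ≡ 4 * k
    identity = solve-∀

  open ResidueSet n cls cls-addₓ p o ℓ cls-p cls-o cls-ℓ ℓ-order

  suc-pred-k : k ≡ suc (k ∸ 1)
  suc-pred-k = sym (m+[n∸m]≡n {1} (≤-trans (s≤s z≤n) 3≤k))

  -- (2k - 2) + 2k + 2 = 4k. With `o′≡`, this recognises q and o′ as the exponents of the single
  -- elements yx⁻² and yx^(2k-1) of the list.
  q≡ : q ≡ ⊖ xexp 2
  q≡ = addₓ-inverseˡ-unique q (xexp 2) (begin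
    p ⊕ ℓ ⊕ xexp 2                                   ≡⟨ cong (_⊕ xexp 2) (xexp-+ (2 * (k ∸ 1)) (2 * k)) ⟩
    xexp (2 * (k ∸ 1) + 2 * k) ⊕ xexp 2              ≡⟨ xexp-+ (2 * (k ∸ 1) + 2 * k) 2 ⟩
    xexp (2 * (k ∸ 1) + 2 * k + 2)                   ≡⟨ cong xexp total ⟩
    xexp n                                           ≡⟨ xexp-n ⟩
    xexp 0                                           ∎)
    where
    open ≡-Reasoning
    identity : ∀ j → 2 * j + 2 * suc j + 2 ≡ 4 * suc j
    identity = solve-∀
    total : 2 * (k ∸ 1) + 2 * k + 2 ≡ 4 * k
    total = trans (cong (λ l → 2 * (k ∸ 1) + 2 * l + 2) suc-pred-k)
            (trans (identity (k ∸ 1)) (cong (4 *_) (sym suc-pred-k)))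

  o′≡ : o′ ≡ xexp (2 * k ∸ 1)
  o′≡ = begin
    o ⊕ ℓ                                 ≡⟨ cong (o ⊕_) (cong xexp (m+[n∸m]≡n {1} 1≤2k)) ⟨
    o ⊕ xexp (1 + (2 * k ∸ 1))            ≡⟨ cong (o ⊕_) (xexp-+ 1 (2 * k ∸ 1)) ⟨
    o ⊕ (xexp 1 ⊕ xexp (2 * k ∸ 1))       ≡⟨ addₓ-assoc o (xexp 1) _ ⟨
    o ⊕ xexp 1 ⊕ xexp (2 * k ∸ 1)         ≡⟨ cong (_⊕ xexp (2 * k ∸ 1)) (addₓ-inverseˡ (xexp 1)) ⟩
    xexp 0 ⊕ xexp (2 * k ∸ 1)             ≡⟨ addₓ-identityˡ _ ⟩
    xexp (2 * k ∸ 1)                      ∎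
    where
    open ≡-Reasoning
    1≤2k : 1 ≤ 2 * k
    1≤2k = ≤-trans (≤-trans (s≤s z≤n) 3≤k) (m≤m+n k (1 * k))

  toℕ-cls : ∀ i → toℕ i ≡ toℕ (cls i) + toℕ i / 4 * 4
  toℕ-cls i = trans (m≡m%n+[m/n]*n (toℕ i) 4)
    (cong (_+ toℕ i / 4 * 4) (sym (trans (cong toℕ (cls-mod i)) (DihedralGroup.toℕ-xexp 4 (toℕ i)))))

  -- Comparison of the list for `Z` with the classified set `S`

  open SigmaK k using (A₁; Zlist; Z)

  A₁⁺ : ∀ i → cls i ≡ 0F → (false , i) ∈ A₁
  A₁⁺ i cls-i = subst (_∈ A₁) (cong (false ,_) (trans (cong xexp 4t≡i) (xexp-toℕ i)))
    -- The witness is the quotient of i by 4; it is in range since it is at most i, which is below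
    -- 4k.
    (∈-map⁺ (λ t → x^ (4 * t)) (∈-upTo⁺ (≤-<-trans (m/n≤m (toℕ i) 4) (toℕ<n i))))
    where
    4t≡i : 4 * (toℕ i / 4) ≡ toℕ i
    4t≡i = trans (*-comm 4 (toℕ i / 4)) (sym (trans (toℕ-cls i) (cong (λ a → toℕ a + toℕ i / 4 * 4) cls-i)))

  A₁⁻ : ∀ {g} → g ∈ A₁ → ∃ λ i → g ≡ (false , i) × cls i ≡ 0F
  A₁⁻ g∈A₁ with ∈-map⁻ (λ t → x^ (4 * t)) g∈A₁
  ... | t , _ , eq = xexp (4 * t) , eq , trans (cls-xexp (4 * t)) (trans (cong (_mod 4) (*-comm 4 t)) (mod4 0 t))

  inA₁∖p : Elt → Bool
  inA₁∖p a = not (does (a ≟ x^ (2 * (k ∸ 1))))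

  part₁ part₂ part₃ : List Elt
  part₁ = map (x^ 2 ·_) A₁
  part₂ = map (y ·_) (filterᵇ inA₁∖p A₁)
  part₃ = (y · x^ (2 * k ∸ 1)) ∷ (y · inv (x^ 2)) ∷ (y · inv (x^ 1)) ∷ []

  y·x≡ : ∀ {i j} → i ≡ j → y · (false , i) ≡ (true , j)
  y·x≡ {i} i≡j = cong (true ,_) (trans (addₓ-identityˡ i) i≡j)

  Zlist⁻ : ∀ {g} → g ∈ Zlist → S g ≡ true
  Zlist⁻ g∈Z = [ in-part₁ , (λ g∈ → [ in-part₂ , in-part₃ ]′ (∈-++⁻ part₂ g∈)) ]′ (∈-++⁻ part₁ g∈Z)
    where
    in-part₁ : ∀ {g} → g ∈ part₁ → S g ≡ true
    in-part₁ g∈ =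
      let a , a∈A₁ , g≡      = ∈-map⁻ (x^ 2 ·_) g∈
          i , a≡ , cls-i     = A₁⁻ a∈A₁
      in trans (cong S (trans g≡ (cong (x^ 2 ·_) a≡)))
               (dec-true (cls (xexp 2 ⊕ i) Fin.≟ 2F) (cls-⊕ (cls-xexp 2) cls-i))
    in-part₂ : ∀ {g} → g ∈ part₂ → S g ≡ true
    in-part₂ g∈ =
      let a , a∈ , g≡        = ∈-map⁻ (y ·_) g∈
          a∈A₁ , a≢p         = ∈-filter⁻ (T? ∘ inA₁∖p) {xs = A₁} a∈
          i , a≡ , cls-i     = A₁⁻ a∈A₁
          i≢p : i ≢ p
          i≢p i≡p = contradiction (trans (sym (T⇒true a≢p))
            (cong not (dec-true (a ≟ (false , p)) (trans a≡ (cong (false ,_) i≡p))))) λ ()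
      in trans (cong S (trans g≡ (trans (cong (y ·_) a≡) (y·x≡ refl))))
               (trans (B-at cls-i) (cong not (dec-false (i Fin.≟ p) i≢p)))
    in-part₃ : ∀ {g} → g ∈ part₃ → S g ≡ true
    in-part₃ (here g≡) =
      trans (cong S (trans g≡ (y·x≡ (sym o′≡)))) (trans (B-at cls-o′) (dec-true (o′ Fin.≟ o′) refl))
    in-part₃ (there (here g≡)) =
      trans (cong S (trans g≡ (y·x≡ (sym q≡)))) (trans (B-at cls-q) (dec-true (q Fin.≟ q) refl))
    in-part₃ (there (there (here g≡))) =
      trans (cong S (trans g≡ (y·x≡ refl))) (trans (B-at cls-o) (dec-true (o Fin.≟ o) refl))

  -- The class decides the block of the list. A rotation has class 2 and comes from x²A₁; a
  -- reflection of class 0 comes from `part₂`, and those of classes 1, 2, 3 are the three single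
  -- elements in the order listed.
  Zlist⁺ : ∀ g → S g ≡ true → g ∈ Zlist
  Zlist⁺ (false , i) i∈2 = ∈-++⁺ˡ (subst (_∈ part₁) (cong (false ,_) shifted)
    (∈-map⁺ (x^ 2 ·_) (A₁⁺ (⊖ xexp 2 ⊕ i) (cls-⊖⊕ (cls-xexp 2) (does-true⁻ (cls i Fin.≟ 2F) i∈2)))))
    where
    shifted : xexp 2 ⊕ (⊖ xexp 2 ⊕ i) ≡ i
    shifted = trans (sym (addₓ-assoc (xexp 2) (⊖ xexp 2) i))
      (trans (cong (_⊕ i) (addₓ-inverseʳ (xexp 2))) (addₓ-identityˡ i))
  Zlist⁺ (true , i) Bi = ∈-++⁺ʳ part₁ (by-class (cls i) refl)
    where
    at : ∀ {j} → cls i ≡ j → Bᶜ j i ≡ true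
    at cls-i = trans (sym (B-at cls-i)) Bi
    special : ∀ {a} → y · (false , a) ∈ part₃ → ∀ {b} → a ≡ b → (i == b) ≡ true → (true , i) ∈ part₂ ++ part₃
    special ∈₃ a≡b i==b = ∈-++⁺ʳ part₂ (subst (_∈ part₃) (y·x≡ (trans a≡b (sym (does-true⁻ (i Fin.≟ _) i==b)))) ∈₃)
    by-class : ∀ j → cls i ≡ j → (true , i) ∈ part₂ ++ part₃
    by-class 0F cls-i = ∈-++⁺ˡ (subst (_∈ part₂) (y·x≡ refl)
      (∈-map⁺ (y ·_) (∈-filter⁺ (T? ∘ inA₁∖p) (A₁⁺ i cls-i) (true⇒T (cong not
        (dec-false ((false , i) ≟ (false , p)) λ eq → contradiction
          (trans (sym (not-injective (at cls-i))) (dec-true (i Fin.≟ p) (,-injectiveʳ eq))) λ ()))))))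
    by-class 1F cls-i = special (here refl) (sym o′≡) (at cls-i)
    by-class 2F cls-i = special (there (here refl)) (sym q≡) (at cls-i)
    by-class 3F cls-i = special (there (there (here refl))) refl (at cls-i)

  S≗Z : S ≗ Z
  S≗Z g = bool-ext
    (λ Sg → T⇒true (any⁺ (λ h → does (g ≟ h))
      (Any.map (λ {h} g≡h → true⇒T (dec-true (g ≟ h) g≡h)) (Zlist⁺ g Sg))))
    (λ Zg → Zlist⁻ (Any.map (λ {h} t → does-true⁻ (g ≟ h) (T⇒true t))
      (any⁻ (λ h → does (g ≟ h)) Zlist (true⇒T Zg))))


  -- Class sizes and the strictly Deza property of Σ(k)

  κ : ℕ
  κ = k ∸ 2

  k≡2+κ : k ≡ 2 + κ
  k≡2+κ = sym (m+[n∸m]≡n {2} (≤-trans (s≤s (s≤s z≤n)) 3≤k))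

  -- k ≥ 3 keeps the two numbers of common neighbours, 2 and 2k - 2, apart.
  κ≢0 : κ ≢ 0
  κ≢0 eq = contradiction (trans k≡2+κ (cong (2 +_) eq)) (λ k≡2 → <⇒≢ 3≤k (sym k≡2))

  -- Translations of the exponents permute the four classes, so each contains a quarter of the 4k
  -- exponents.
  class-size : ∀ j → # (_∈ᶜ j) (allFin n) ≡ 2 + κ
  class-size j = trans (*-cancelˡ-≡ _ k 4 (begin
    4 * size j                                              ≡⟨ identity (size j) ⟩
    size j + size j + size j + size j
      ≡⟨ cong₂ _+_ (cong₂ _+_ (cong₂ _+_ (equal j 0F) (equal j 1F)) (equal j 2F)) (equal j 3F) ⟩
    size 0F + size 1F + size 2F + size 3F                   ≡⟨ #-classes (λ _ → true) ⟨
    # (λ _ → true) (allFin n)                               ≡⟨ #-all (λ _ → refl) (allFin n) ⟩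
    length (allFin n)                                       ≡⟨ length-tabulate id ⟩
    4 * k                                                   ∎)) k≡2+κ
    where
    open ≡-Reasoning
    identity : ∀ s → 4 * s ≡ s + s + s + s
    identity = solve-∀
    size : Fin 4 → ℕ
    size j = # (_∈ᶜ j) (allFin n)
    equal-0F : ∀ j → size j ≡ size 0F
    equal-0F j = trans (#-cong (λ i → trans (shift (cls i) j)
      (cong (λ a → does (a Fin.≟ 0F)) (sym (trans (cls-addₓ i _) (cong (cls i +₄_) cls-back))))) (allFin n))
      (#-translate (xexp (toℕ (-₄ j))) (_∈ᶜ 0F))
      where
      cls-back : cls (xexp (toℕ (-₄ j))) ≡ -₄ j
      cls-back = trans (cls-xexp _) (DihedralGroup.xexp-toℕ 4 (-₄ j))
      shift : ∀ a j → does (a Fin.≟ j) ≡ does ((a +₄ (-₄ j)) Fin.≟ 0F)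
      shift = toWitness {a? = all? λ a → all? λ j → _ ≟ᵇ _} _
    equal : ∀ i j → size i ≡ size j
    equal i j = trans (equal-0F i) (sym (equal-0F j))

  strictlyDeza : Cay.IsStrictlyDeza Z
  strictlyDeza = isStrictlyDeza-cong elements (λ g h → S≗Z (h · inv g)) (Counts.isStrictlyDeza κ class-size κ≢0)

  -- Parity and halves of exponents

  odd₄-parity : ∀ i → toℕ i % 2 ≡ 𝟙 (odd₄ (cls i))
  odd₄-parity i = begin
    toℕ i % 2                  ≡⟨ m∣n⇒o%n%m≡o%m 2 4 (toℕ i) (m∣m*n 2) ⟨
    toℕ i % 4 % 2              ≡⟨ cong (_% 2) (trans (cong toℕ (cls-mod i)) (DihedralGroup.toℕ-xexp 4 (toℕ i))) ⟨
    toℕ (cls i) % 2            ≡⟨ parity₄ (cls i) ⟩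
    𝟙 (odd₄ (cls i))           ∎
    where
    open ≡-Reasoning
    parity₄ : ∀ a → toℕ a % 2 ≡ 𝟙 (odd₄ a)
    parity₄ 0F = refl
    parity₄ 1F = refl
    parity₄ 2F = refl
    parity₄ 3F = refl

  half : Fin n → ℕ
  half i = toℕ i / 2

  toℕ-half : ∀ i → toℕ i ≡ 𝟙 (odd₄ (cls i)) + half i * 2
  toℕ-half i = trans (m≡m%n+[m/n]*n (toℕ i) 2) (cong (_+ half i * 2) (odd₄-parity i))

  half-injective : ∀ {i j} → odd₄ (cls i) ≡ odd₄ (cls j) → half i ≡ half j → i ≡ j
  half-injective {i} {j} odd≡ half≡ = toℕ-injective (begin
    toℕ i                                  ≡⟨ toℕ-half i ⟩
    𝟙 (odd₄ (cls i)) + half i * 2          ≡⟨ cong₂ (λ b h → 𝟙 b + h * 2) odd≡ half≡ ⟩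
    𝟙 (odd₄ (cls j)) + half j * 2          ≡⟨ toℕ-half j ⟨
    toℕ j                                  ∎) where open ≡-Reasoning

  -- As -q = 2, each step adds 2, and an even exponent i is reached from 0 after `half i` steps.
  even-induction : (P : Fin n → Set) → P (xexp 0) → (∀ i → P i → P (i ⊕ (⊖ q))) →
                   ∀ i → odd₄ (cls i) ≡ false → P i
  even-induction P P0 step i even = subst P (begin
    xexp (half i * 2)                           ≡⟨ cong (λ b → xexp (𝟙 b + half i * 2)) even ⟨
    xexp (𝟙 (odd₄ (cls i)) + half i * 2)        ≡⟨ cong xexp (toℕ-half i) ⟨
    xexp (toℕ i)                                ≡⟨ xexp-toℕ i ⟩
    i                                           ∎) (evens (half i))
    where
    open ≡-Reasoning
    evens : ∀ t → P (xexp (t * 2))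
    evens 0       = P0
    evens (suc t) = subst P (begin
      xexp (t * 2) ⊕ (⊖ q)              ≡⟨ cong (λ a → xexp (t * 2) ⊕ (⊖ a)) q≡ ⟩
      xexp (t * 2) ⊕ (⊖ (⊖ xexp 2))     ≡⟨ cong (xexp (t * 2) ⊕_) (negₓ-involutive (xexp 2)) ⟩
      xexp (t * 2) ⊕ xexp 2             ≡⟨ xexp-+ (t * 2) 2 ⟩
      xexp (t * 2 + 2)                  ≡⟨ cong xexp (+-comm (t * 2) 2) ⟩
      xexp (suc t * 2)                  ∎) (step (xexp (t * 2)) (evens t))

  xexp-injective : ∀ {a b} → a < n → b < n → xexp a ≡ xexp b → a ≡ b
  xexp-injective {a} {b} a<n b<n eq = begin
    a              ≡⟨ m<n⇒m%n≡m a<n ⟨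
    a % n          ≡⟨ toℕ-xexp a ⟨
    toℕ (xexp a)   ≡⟨ cong toℕ eq ⟩
    toℕ (xexp b)   ≡⟨ toℕ-xexp b ⟩
    b % n          ≡⟨ m<n⇒m%n≡m b<n ⟩
    b              ∎ where open ≡-Reasoning

  private
    0<k : 0 < k
    0<k = ≤-trans (s≤s z≤n) 3≤k

    2k<n : 2 * k < n
    2k<n = *-monoˡ-< k {{>-nonZero 0<k}} {2} {4} (s≤s (s≤s (s≤s z≤n)))

    2<2k : 2 < 2 * k
    2<2k = ≤-trans 3≤k (m≤m+n k (1 * k))

  p≢0 : p ≢ xexp 0
  p≢0 eq = contradiction (*-cancelˡ-≡ _ 0 2 (xexp-injective
    (≤-<-trans (*-monoʳ-≤ 2 (m∸n≤m k 1)) 2k<n) (≤-<-trans z≤n 2k<n) eq))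
    (m>n⇒m∸n≢0 (≤-trans (s≤s (s≤s z≤n)) 3≤k))

  δ⊕δ≢ℓ : xexp 1 ⊕ xexp 1 ≢ ℓ
  δ⊕δ≢ℓ eq = <⇒≢ 2<2k (xexp-injective (<-trans 2<2k 2k<n) 2k<n (trans (sym (xexp-+ 1 1)) eq))

  q⊕δ : q ⊕ xexp 1 ≡ o
  q⊕δ = addₓ-inverseˡ-unique (q ⊕ xexp 1) (xexp 1) (begin
    q ⊕ xexp 1 ⊕ xexp 1         ≡⟨ addₓ-assoc q (xexp 1) (xexp 1) ⟩
    q ⊕ (xexp 1 ⊕ xexp 1)       ≡⟨ cong₂ _⊕_ q≡ (xexp-+ 1 1) ⟩
    ⊖ xexp 2 ⊕ xexp 2           ≡⟨ addₓ-inverseˡ (xexp 2) ⟩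
    xexp 0                      ∎) where open ≡-Reasoning

  -- The colouring with 6k colours

  module Exponents (2k : ℕ) .{{_ : NonZero 2k}} (2k≡ : 2k ≡ 2 * k) where

    n≡2k*2 : n ≡ 2k * 2
    n≡2k*2 = trans (identity k) (cong (_* 2) (sym 2k≡))
      where
      identity : ∀ k → 4 * k ≡ 2 * k * 2
      identity = solve-∀

    k∣2k : k ∣ 2k
    k∣2k = subst (k ∣_) (sym 2k≡) (n∣m*n 2)

    -- The odd exponents i and i + 2k have halves differing by k.
    exponentColour : Fin n → Fin 2k ⊎ Fin k
    exponentColour i = if odd₄ (cls i) then inj₂ (half i mod k) else inj₁ (half i mod 2k)

    exponentColour-odd : ∀ {i} → odd₄ (cls i) ≡ true → exponentColour i ≡ inj₂ (half i mod k)
    exponentColour-odd odd-i rewrite odd-i = refl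

    exponentColour-even : ∀ {i} → odd₄ (cls i) ≡ false → exponentColour i ≡ inj₁ (half i mod 2k)
    exponentColour-even even-i rewrite even-i = refl

    mod≡⇒%≡ : ∀ d .{{_ : NonZero d}} {a b} → a mod d ≡ b mod d → a % d ≡ b % d
    mod≡⇒%≡ d {a} {b} eq = trans (sym (DihedralGroup.toℕ-xexp d a)) (trans (cong toℕ eq) (DihedralGroup.toℕ-xexp d b))

    half<2k : ∀ i → half i < 2k
    half<2k i = m<n*o⇒m/o<n (subst (toℕ i <_) n≡2k*2 (toℕ<n i))

    -- Adding ℓ = 2k adds k to the half, and reduction modulo 4k turns into reduction modulo 2k.
    half-⊕ℓ : ∀ i → half (i ⊕ ℓ) % 2k ≡ (half i + k) % 2k
    half-⊕ℓ i = begin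
      half (i ⊕ ℓ) % 2k                         ≡⟨ cong (λ a → a / 2 % 2k) toℕ-⊕ℓ ⟩
      ((toℕ i + k * 2) % n) / 2 % 2k            ≡⟨ cong (_% 2k) (%-/-comm (toℕ i + k * 2) n≡2k*2) ⟩
      (toℕ i + k * 2) / 2 % 2k % 2k             ≡⟨ m%n%n≡m%n _ 2k ⟩
      (toℕ i + k * 2) / 2 % 2k                  ≡⟨ cong (_% 2k) (+-distrib-/-∣ʳ (toℕ i) (n∣m*n k)) ⟩
      (toℕ i / 2 + k * 2 / 2) % 2k              ≡⟨ cong (λ a → (half i + a) % 2k) (m*n/n≡m k 2) ⟩
      (half i + k) % 2k                         ∎
      where
      open ≡-Reasoning
      toℕ-⊕ℓ : toℕ (i ⊕ ℓ) ≡ (toℕ i + k * 2) % n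
      toℕ-⊕ℓ = begin
        toℕ (i ⊕ ℓ)                          ≡⟨ cong (λ j → toℕ (j ⊕ ℓ)) (xexp-toℕ i) ⟨
        toℕ (xexp (toℕ i) ⊕ ℓ)               ≡⟨ cong toℕ (xexp-+ (toℕ i) (2 * k)) ⟩
        toℕ (xexp (toℕ i + 2 * k))           ≡⟨ toℕ-xexp _ ⟩
        (toℕ i + 2 * k) % n                  ≡⟨ cong (λ a → (toℕ i + a) % n) (*-comm 2 k) ⟩
        (toℕ i + k * 2) % n                  ∎

    exponentColour-twin : ∀ {i} → odd₄ (cls i) ≡ true → exponentColour (i ⊕ ℓ) ≡ exponentColour i
    exponentColour-twin {i} odd-i = begin
      exponentColour (i ⊕ ℓ)         ≡⟨ exponentColour-odd (trans (odd-twin (false , i)) odd-i) ⟩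
      inj₂ (half (i ⊕ ℓ) mod k)      ≡⟨ cong inj₂ (DihedralGroup.xexp-cong k {half (i ⊕ ℓ)} {half i} half≡) ⟩
      inj₂ (half i mod k)            ≡⟨ exponentColour-odd odd-i ⟨
      exponentColour i               ∎
      where
      open ≡-Reasoning
      half≡ : half (i ⊕ ℓ) % k ≡ half i % k
      half≡ = begin
        half (i ⊕ ℓ) % k               ≡⟨ m∣n⇒o%n%m≡o%m k 2k _ k∣2k ⟨
        half (i ⊕ ℓ) % 2k % k     ≡⟨ cong (_% k) (half-⊕ℓ i) ⟩
        (half i + k) % 2k % k     ≡⟨ m∣n⇒o%n%m≡o%m k 2k _ k∣2k ⟩
        (half i + k) % k               ≡⟨ [m+n]%n≡m%n (half i) k ⟩
        half i % k                     ∎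

    -- Both quotients by k are 0 or 1. Equal quotients give equal numbers; different ones give a
    -- distance of k, and modulo 2k it makes no difference which number is the larger.
    %k-fibre : ∀ {a b} → a < 2k → b < 2k → a % k ≡ b % k → a ≡ b ⊎ a ≡ (b + k) % 2k
    %k-fibre {a} {b} a<2k b<2k eq = by-quotients (a / k) (b / k) refl refl (quotient<2 a<2k) (quotient<2 b<2k)
      where
      quotient<2 : ∀ {a} → a < 2k → a / k < 2
      quotient<2 {a} a<2k = m<n*o⇒m/o<n (subst (a <_) 2k≡ a<2k)
      a≡ : a ≡ b % k + a / k * k
      a≡ = trans (m≡m%n+[m/n]*n a k) (cong (_+ a / k * k) eq)
      b≡ : b ≡ b % k + b / k * k
      b≡ = m≡m%n+[m/n]*n b k
      by-quotients : ∀ s t → a / k ≡ s → b / k ≡ t → s < 2 → t < 2 → a ≡ b ⊎ a ≡ (b + k) % 2k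
      by-quotients 0 0 s≡ t≡ _ _ = inj₁ (trans a≡ (trans (cong (λ u → b % k + u * k) (trans s≡ (sym t≡))) (sym b≡)))
      by-quotients 1 1 s≡ t≡ _ _ = inj₁ (trans a≡ (trans (cong (λ u → b % k + u * k) (trans s≡ (sym t≡))) (sym b≡)))
      by-quotients 1 0 s≡ t≡ _ _ = inj₂ (trans (sym (m<n⇒m%n≡m a<2k)) (cong (_% 2k) (begin
        a                            ≡⟨ a≡ ⟩
        b % k + a / k * k            ≡⟨ cong (λ u → b % k + u * k) s≡ ⟩
        b % k + 1 * k                ≡⟨ identity (b % k) k ⟩
        b % k + 0 * k + k            ≡⟨ cong (λ u → b % k + u * k + k) t≡ ⟨
        b % k + b / k * k + k        ≡⟨ cong (_+ k) b≡ ⟨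
        b + k                        ∎)))
        where
        open ≡-Reasoning
        identity : ∀ r k → r + 1 * k ≡ r + 0 * k + k
        identity = solve-∀
      -- Here b + k = a + 2k, and the reduction removes the 2k.
      by-quotients 0 1 s≡ t≡ _ _ = inj₂ (sym (begin
        (b + k) % 2k                    ≡⟨ cong (λ b → (b + k) % 2k) b≡ ⟩
        (b % k + b / k * k + k) % 2k    ≡⟨ cong (λ u → (b % k + u * k + k) % 2k) t≡ ⟩
        (b % k + 1 * k + k) % 2k        ≡⟨ cong (_% 2k) (identity (b % k)) ⟩
        (b % k + 0 * k + 2k) % 2k    ≡⟨ cong (λ u → (b % k + u * k + 2k) % 2k) s≡ ⟨
        (b % k + a / k * k + 2k) % 2k ≡⟨ cong (λ a → (a + 2k) % 2k) a≡ ⟨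
        (a + 2k) % 2k                ≡⟨ [m+n]%n≡m%n a 2k ⟩
        a % 2k                          ≡⟨ m<n⇒m%n≡m a<2k ⟩
        a                                    ∎))
        where
        open ≡-Reasoning
        identity : ∀ r → r + 1 * k + k ≡ r + 0 * k + 2k
        identity r = trans (ring r k) (cong (r + 0 * k +_) (sym 2k≡))
          where
          ring : ∀ r k → r + 1 * k + k ≡ r + 0 * k + 2 * k
          ring = solve-∀
      by-quotients (suc (suc _)) _ _ _ (s≤s (s≤s ())) _
      by-quotients _ (suc (suc _)) _ _ _ (s≤s (s≤s ()))

    -- Different parities land in different summands. The half of an even exponent lies below 2k and
    -- is determined by its residue. For odd exponents the residue modulo k leaves two halves, that
    -- of i and the one k further on modulo 2k, which belongs to `i ⊕ ℓ`.
    exponentColour-separates : ∀ {i j} → exponentColour i ≡ exponentColour j →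
                               j ≡ i ⊎ (odd₄ (cls i) ≡ true × j ≡ i ⊕ ℓ)
    exponentColour-separates {i} {j} eq = by-parity (odd₄ (cls i)) (odd₄ (cls j)) refl refl
      where
      by-parity : ∀ a b → odd₄ (cls i) ≡ a → odd₄ (cls j) ≡ b → j ≡ i ⊎ (odd₄ (cls i) ≡ true × j ≡ i ⊕ ℓ)
      by-parity false true i-even j-odd =
        contradiction (trans (sym (exponentColour-even i-even)) (trans eq (exponentColour-odd j-odd))) λ ()
      by-parity true false i-odd j-even =
        contradiction (trans (sym (exponentColour-odd i-odd)) (trans eq (exponentColour-even j-even))) λ ()
      by-parity false false i-even j-even = inj₁ (half-injective (trans j-even (sym i-even)) (begin
        half j              ≡⟨ m<n⇒m%n≡m (half<2k j) ⟨
        half j % 2k    ≡⟨ mod≡⇒%≡ 2k {half i} {half j} (inj₁-injective (trans (sym (exponentColour-even i-even))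
                                 (trans eq (exponentColour-even j-even)))) ⟨
        half i % 2k    ≡⟨ m<n⇒m%n≡m (half<2k i) ⟩
        half i              ∎))
        where open ≡-Reasoning
      by-parity true true i-odd j-odd = Sum.map
        (half-injective (trans j-odd (sym i-odd)))
        (λ half-j → i-odd , half-injective (trans j-odd (sym (trans (odd-twin (false , i)) i-odd)))
          (trans half-j (trans (sym (half-⊕ℓ i)) (m<n⇒m%n≡m (half<2k (i ⊕ ℓ))))))
        (%k-fibre (half<2k j) (half<2k i) (sym (mod≡⇒%≡ k {half i} {half j} (inj₂-injective
          (trans (sym (exponentColour-odd i-odd)) (trans eq (exponentColour-odd j-odd)))))))

    exponentColour-surjective : ∀ c → ∃ λ i → exponentColour i ≡ c
    exponentColour-surjective (inj₁ t) = i , (begin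
      exponentColour i          ≡⟨ exponentColour-even even-i ⟩
      inj₁ (half i mod 2k)      ≡⟨ cong (λ a → inj₁ (a mod 2k)) half-i ⟩
      inj₁ (toℕ t mod 2k)       ≡⟨ cong inj₁ (DihedralGroup.xexp-toℕ 2k t) ⟩
      inj₁ t                    ∎)
      where
      open ≡-Reasoning
      i : Fin n
      i = xexp (toℕ t * 2)
      toℕ-i : toℕ i ≡ toℕ t * 2
      toℕ-i = trans (toℕ-xexp (toℕ t * 2)) (m<n⇒m%n≡m
        (subst (toℕ t * 2 <_) (sym n≡2k*2) (*-monoˡ-< 2 (toℕ<n t))))
      half-i : half i ≡ toℕ t
      half-i = trans (cong (_/ 2) toℕ-i) (m*n/n≡m (toℕ t) 2)
      even-i : odd₄ (cls i) ≡ false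
      even-i = 𝟙-injective (trans (sym (odd₄-parity i)) (trans (cong (_% 2) toℕ-i) (m*n%n≡0 (toℕ t) 2)))
    exponentColour-surjective (inj₂ t) = i , (begin
      exponentColour i          ≡⟨ exponentColour-odd odd-i ⟩
      inj₂ (half i mod k)       ≡⟨ cong (λ a → inj₂ (a mod k)) half-i ⟩
      inj₂ (toℕ t mod k)        ≡⟨ cong inj₂ (DihedralGroup.xexp-toℕ k t) ⟩
      inj₂ t                    ∎)
      where
      open ≡-Reasoning
      i : Fin n
      i = xexp (1 + toℕ t * 2)
      1+2t<n : 1 + toℕ t * 2 < n
      -- 1 + 2t < 2(t + 1) ≤ 2k ≤ 4k.
      1+2t<n = ≤-trans (*-monoˡ-≤ 2 (toℕ<n t)) (≤-trans (≤-reflexive (*-comm k 2)) (<⇒≤ 2k<n))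
      toℕ-i : toℕ i ≡ 1 + toℕ t * 2
      toℕ-i = trans (toℕ-xexp (1 + toℕ t * 2)) (m<n⇒m%n≡m 1+2t<n)
      odd-i : odd₄ (cls i) ≡ true
      odd-i = 𝟙-injective (trans (sym (odd₄-parity i)) (trans (cong (_% 2) toℕ-i) ([m+kn]%n≡m%n 1 (toℕ t) 2)))
      half-i : half i ≡ toℕ t
      half-i = *-cancelʳ-≡ (half i) (toℕ t) 2 (suc-injective (begin
        1 + half i * 2                       ≡⟨ cong (λ b → 𝟙 b + half i * 2) odd-i ⟨
        𝟙 (odd₄ (cls i)) + half i * 2        ≡⟨ toℕ-half i ⟨
        toℕ i                                ≡⟨ toℕ-i ⟩
        1 + toℕ t * 2                        ∎))

    side : Bool → Fin (2k + k) → Fin (2k + k) ⊎ Fin (2k + k)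
    side false = inj₁
    side true  = inj₂

    side-injective : ∀ b b′ {i j} → side b i ≡ side b′ j → b ≡ b′ × i ≡ j
    side-injective false false refl = refl , refl
    side-injective true  true  refl = refl , refl

    join-injective : ∀ m n {c d} → join m n c ≡ join m n d → c ≡ d
    join-injective m n {c} {d} eq = trans (sym (splitAt-join m n c)) (trans (cong (splitAt m) eq) (splitAt-join m n d))

    -- Rotations and reflections each receive 2k colours for the even exponents and k colours for
    -- the pairs of odd ones, which makes 6k.
    colour : Elt → Fin ((2k + k) + (2k + k))
    colour (b , i) = join (2k + k) (2k + k) (side b (join 2k k (exponentColour i)))

    colour-separates : ∀ g h → colour g ≡ colour h → h ≡ g ⊎ (odd g ≡ true × h ≡ twin g)
    colour-separates (b , i) (b′ , j) eq =
      let b≡b′ , eq′ = side-injective b b′ (join-injective (2k + k) (2k + k) eq)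
      in Sum.map (cong₂ _,_ (sym b≡b′)) (λ (odd-i , j≡) → odd-i , cong₂ _,_ (sym b≡b′) j≡)
                 (exponentColour-separates (join-injective 2k k eq′))

    colour-twin : ∀ g → odd g ≡ true → colour (twin g) ≡ colour g
    colour-twin (b , i) odd-g = cong (λ c → join (2k + k) (2k + k) (side b (join 2k k c))) (exponentColour-twin odd-g)

    colour-surjective : ∀ c → ∃ λ g → colour g ≡ c
    colour-surjective c =
      let b , d , side≡ = unside (splitAt (2k + k) c)
          i , exponent≡ = exponentColour-surjective (splitAt 2k d)
      in (b , i) , (begin
        join (2k + k) (2k + k) (side b (join 2k k (exponentColour i)))
          ≡⟨ cong (λ x → join (2k + k) (2k + k) (side b (join 2k k x))) exponent≡ ⟩
        join (2k + k) (2k + k) (side b (join 2k k (splitAt 2k d)))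
          ≡⟨ cong (λ x → join (2k + k) (2k + k) (side b x)) (join-splitAt 2k k d) ⟩
        join (2k + k) (2k + k) (side b d)
          ≡⟨ cong (join (2k + k) (2k + k)) side≡ ⟩
        join (2k + k) (2k + k) (splitAt (2k + k) c)
          ≡⟨ join-splitAt (2k + k) (2k + k) c ⟩
        c ∎)
      where
      open ≡-Reasoning
      unside : ∀ x → ∃ λ b → ∃ λ d → side b d ≡ x
      unside (inj₁ d) = false , d , refl
      unside (inj₂ d) = true , d , refl

    open Colouring colour colour-surjective colour-separates colour-twin

    -- In a competing S-ring, two elements of one basic set are equal or odd twins by `~⇒twin`, and
    -- `colour` does not tell odd twins apart.
    wlRank : WLRank S ((2k + k) + (2k + k))
    wlRank = colour , colour-isSRing , S-isUnionOfBasic , λ r c isSRing union g h g~h →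
      [ cong colour ∘ sym , (λ (odd-g , h≡) → trans (sym (colour-twin g odd-g)) (cong colour (sym h≡))) ]′
        (Minimality.~⇒twin κ class-size κ≢0 (xexp 1) q⊕δ (addₓ-inverseˡ (xexp 1)) p≢0 δ⊕δ≢ℓ even-induction
          c isSRing union g h g~h)

  wlRank-Z : WLRank Z (6 * k)
  wlRank-Z = WLRank-cong n S≗Z (subst (WLRank S) (identity k)
    (Exponents.wlRank (2 * k) {{m*n≢0 2 k}} refl))
    where
    identity : ∀ k → (2 * k + k) + (2 * k + k) ≡ 6 * k
    identity = solve-∀

theorem1p3 : (k : ℕ) .{{_ : NonZero k}} → 3 ≤ k → Odd k →
    Dihedral.Cay.IsStrictlyDeza (4 * k) (SigmaK.Z k)
    × Dihedral.WLRank (4 * k) (SigmaK.Z k) (6 * k)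
theorem1p3 k 3≤k odd-k = Sigma.strictlyDeza k 3≤k odd-k , Sigma.wlRank-Z k 3≤k odd-k
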